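{- Let $\lambda$ be a partition and $\pi$ a reverse plane partition of shape $\lambda$. Then there exists a sequence of rim-hooks $h_1,\dots,h_s$ of $\lambda$ such that $h_i$ inserts into $h_{i-1}*\cdots*h_1*0$ for all $i\in\{1,\dots,s\}$ and $\pi=h_s*\cdots*h_1*0$, where $0$ is the zero reverse plane partition of shape $\lambda$.
   Context: Cells are pairs $(i,j)\in\mathbb Z^2$; $\mathrm n(i,j)=(i-1,j)$, $\mathrm e(i,j)=(i,j+1)$, $\mathrm s(i,j)=(i+1,j)$, $\mathrm w(i,j)=(i,j-1)$. A partition $\lambda$ is identified with its Young diagram. A reverse plane partition of shape $\lambda$ is $\pi:\lambda\to\mathbb N$ with $\pi(u)\le\pi(\mathrm e u),\pi(\mathrm s u)$, with conventions $\pi(i,j)=0$ if $i\le0$ or $j\le0$, $\pi(i,j)=\infty$ if $i,j\ge1$, $(i,j)\notin\lambda$. Content $c(i,j)=j-i$; outer corner: $u\in\lambda$, $\mathrm e u,\mathrm s u\notin\lambda$; inner corner: $\mathrm e u,\mathrm s u\in\lambda$, $\mathrm e\mathrm s u\notin\lambda$. With inner corner contents $i_1<\dots<i_r$ and outer corner contents $o_1<\dots<o_{r+1}$ (interlacing), $\mathcal I=\{u\in\lambda:c(u)=i_k\}$, $\mathcal O=\{u\in\lambda:c(u)=o_k\}$, $\mathcal A=\{u\in\lambda:c(u)<o_1\text{ or }i_k<c(u)<o_{k+1}\text{ for some }k\in[r]\}$, $\mathcal B=\{u\in\lambda:o_k<c(u)<i_k\text{ for some }k\in[r]\text{ or }c(u)>o_{r+1}\}$.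 North-east path: $(u_0,\dots,u_s)$ in $\lambda$, $u_k\in\{\mathrm n u_{k-1},\mathrm e u_{k-1}\}$, length $s$, head $\alpha=u_0$, tail $\omega=u_s$. South-west path: $(v_0,\dots,v_s)$, $v_k\in\{\mathrm s v_{k-1},\mathrm w v_{k-1}\}$, length $s$, $\alpha=v_s$, $\omega=v_0$. Rim-hook: north-east path $h$ with $\mathrm s\alpha(h)\notin\lambda$, $\mathrm e\omega(h)\notin\lambda$, $\mathrm e\mathrm s u\notin\lambda$ for all $u\in h$. $(\pi+P)(u)=\pi(u)+1$ for $u\in P$, else $\pi(u)$. $(P,\pi)$ compatible: $u\in P\cap(\mathcal I\cup\mathcal A)$ implies $\mathrm e u\in P$ and $\pi(u)=\pi(\mathrm e u)$; $u,\mathrm s u\in P$ implies $\pi(u)=\pi(\mathrm s u)$. $h$ inserts into $\pi$ if some path $P$ has $\omega(P)=\omega(h)$, $\ell(P)=\ell(h)$, $(P,\pi)$ compatible and $\pi+P$ a reverse plane partition; then $h*\pi=\pi+P(h,\pi)$, with $P(h,\pi)$ the south-west path starting at $\omega(h)$ which, while its length is less than $\ell(h)$, moves from current cell $u$ to $\mathrm s u$ if $u\in\mathcal B\cup\mathcal I$ and $\pi(u)=\pi(\mathrm s u)$, and to $\mathrm w u$ otherwise. Iterated insertion is read right to left: $h_s*\cdots*h_1*0=h_s*(\cdots(h_1*0))$. -}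

module Defs where

open import Data.Bool using (Bool; true; false; _∧_; _∨_; if_then_else_)
open import Data.Nat as ℕ using (ℕ; zero; suc; _≤_; _<_; pred)
open import Data.Integer as ℤ using (ℤ; +_; _-_)
import Data.Integer.Properties as ℤP
open import Data.Product using (_×_; _,_; Σ; ∃; ∃-syntax; proj₁; proj₂)
import Data.Product.Properties as ×P
open import Data.List using (List; []; _∷_; length; filter; map; zip)
open import Data.Bool.ListAction using (any)
open import Data.List.Relation.Unary.All using (All)
open import Data.List.Relation.Unary.Linked using (Linked)
open import Data.List.Membership.Propositional using (_∈_)
open import Data.List.Sort.Base using (SortingAlgorithm)
open import Data.List.Sort.MergeSort ℤP.≤-decTotalOrder using (mergeSort)
open import Data.Unit using (⊤)
open import Data.Sum using (_⊎_)
open import Relation.Nullary using (¬_; Dec; does)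
open import Relation.Binary.PropositionalEquality using (_≡_)
import Data.List.Membership.DecPropositional as DecMem

data Decreasing : List ℕ → Set where
  dec-[]  : Decreasing []
  dec-[-] : ∀ {a} → Decreasing (a ∷ [])
  dec-∷   : ∀ {a b xs} → b ≤ a → Decreasing (b ∷ xs) → Decreasing (a ∷ b ∷ xs)

IsPartition : List ℕ → Set
IsPartition λ′ = Decreasing λ′ × All (λ r → 1 ≤ r) λ′

-- A cell (i , j) : row i, column j.  Cells of a Young diagram have
-- i , j ≥ 1; coordinates ≤ 0 are represented by 0 (such cells are never
-- in a diagram, and values there are never consulted).
Cell : Set
Cell = ℕ × ℕ

_≟ᶜ_ : (u v : Cell) → Dec (u ≡ v)
_≟ᶜ_ = ×P.≡-dec ℕ._≟_ ℕ._≟_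

nC eC sC wC : Cell → Cell
nC (i , j) = (pred i , j)
eC (i , j) = (i , suc j)
sC (i , j) = (suc i , j)
wC (i , j) = (i , pred j)

-- length of row i (1-indexed); 0 for i = 0 or i beyond the last row
rowLen : List ℕ → ℕ → ℕ
rowLen λ′ zero = 0
rowLen [] (suc i) = 0
rowLen (r ∷ rs) (suc zero) = r
rowLen (r ∷ rs) (suc (suc i)) = rowLen rs (suc i)

inλᵇ : List ℕ → Cell → Bool
inλᵇ λ′ (i , j) = does (1 ℕ.≤? j) ∧ does (j ℕ.≤? rowLen λ′ i)

_∈λ_ : Cell → List ℕ → Set
u ∈λ λ′ = inλᵇ λ′ u ≡ true

cellsFrom : ℕ → List ℕ → List Cell
cellsFrom i [] = []
cellsFrom i (r ∷ rs) = map (λ j → (i , j)) (Data.List.applyUpTo suc r) Data.List.++ cellsFrom (suc i) rs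
  where import Data.List

cells : List ℕ → List Cell
cells λ′ = cellsFrom 1 λ′

content : Cell → ℤ
content (i , j) = + j - + i

not : Bool → Bool
not true = false
not false = true

isOuterCornerᵇ : List ℕ → Cell → Bool
isOuterCornerᵇ λ′ u = inλᵇ λ′ u ∧ not (inλᵇ λ′ (eC u)) ∧ not (inλᵇ λ′ (sC u))

isInnerCornerᵇ : List ℕ → Cell → Bool
isInnerCornerᵇ λ′ u = inλᵇ λ′ (eC u) ∧ inλᵇ λ′ (sC u) ∧ not (inλᵇ λ′ (eC (sC u)))

sortℤ : List ℤ → List ℤ
sortℤ = SortingAlgorithm.sort mergeSort

-- inner corner contents i₁ < … < i_r  and outer corner contents o₁ < … < o_{r+1}
innerContents : List ℕ → List ℤ
innerContents λ′ = sortℤ (map content (filter (λ u → isInnerCornerᵇ λ′ u Data.Bool.≟ true) (cells λ′)))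
  where import Data.Bool

outerContents : List ℕ → List ℤ
outerContents λ′ = sortℤ (map content (filter (λ u → isOuterCornerᵇ λ′ u Data.Bool.≟ true) (cells λ′)))
  where import Data.Bool

_<ᶻ_ : ℤ → ℤ → Bool
a <ᶻ b = does (a ℤ.<? b)

_==ᶻ_ : ℤ → ℤ → Bool
a ==ᶻ b = does (a ℤ.≟ b)

lastℤ : ℤ → List ℤ → ℤ
lastℤ a [] = a
lastℤ a (b ∷ bs) = lastℤ b bs

-- c ∈ (i_k , o_{k+1}) for some k, given is = i₁…i_r and os = o₂…o_{r+1}
-- A-condition, given the sorted lists o and i
condA : ℤ → List ℤ → List ℤ → Bool
condA c [] is = false
condA c (o₁ ∷ os) is =
  (c <ᶻ o₁) ∨ any (λ p → (proj₁ p <ᶻ c) ∧ (c <ᶻ proj₂ p)) (zip is os)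

condB : ℤ → List ℤ → List ℤ → Bool
condB c [] is = false
condB c (o₁ ∷ os) is =
  any (λ p → (proj₁ p <ᶻ c) ∧ (c <ᶻ proj₂ p)) (zip (o₁ ∷ os) is) ∨ (lastℤ o₁ os <ᶻ c)

inIᵇ inAᵇ inBᵇ : List ℕ → Cell → Bool
inIᵇ λ′ u = inλᵇ λ′ u ∧ any (λ i → content u ==ᶻ i) (innerContents λ′)
inAᵇ λ′ u = inλᵇ λ′ u ∧ condA (content u) (outerContents λ′) (innerContents λ′)
inBᵇ λ′ u = inλᵇ λ′ u ∧ condB (content u) (outerContents λ′) (innerContents λ′)

-- A filling assigns a natural number to every cell; only the values on
-- cells of λ matter (the conventions 0 / ∞ outside λ are encoded by the
-- guards in the definitions below).
Filling : Set
Filling = Cell → ℕ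

IsRPP : List ℕ → Filling → Set
IsRPP λ′ π = ∀ u → u ∈λ λ′ →
  (eC u ∈λ λ′ → π u ≤ π (eC u)) × (sC u ∈λ λ′ → π u ≤ π (sC u))

zeroF : Filling
zeroF _ = 0

_≈[_]_ : Filling → List ℕ → Filling → Set
π ≈[ λ′ ] σ = ∀ u → u ∈λ λ′ → π u ≡ σ u

-- A north-east path (u₀ , u₁ ∷ … ∷ u_s) : head α = u₀, tail ω = u_s.
-- (A south-west path is the same set of cells traversed backwards.)
Path : Set
Path = Cell × List Cell

pathCells : Path → List Cell
pathCells (a , us) = a ∷ us

αP : Path → Cell
αP (a , us) = a

lastC : Cell → List Cell → Cell
lastC a [] = a
lastC a (b ∷ bs) = lastC b bs

ωP : Path → Cell
ωP (a , us) = lastC a us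

lenP : Path → ℕ
lenP (a , us) = length us

NEStep : Cell → Cell → Set
NEStep u v = (v ≡ nC u) ⊎ (v ≡ eC u)

IsNEPath : List ℕ → Path → Set
IsNEPath λ′ P = All (λ u → u ∈λ λ′) (pathCells P) × Linked NEStep (pathCells P)

IsRimHook : List ℕ → Path → Set
IsRimHook λ′ h = IsNEPath λ′ h
  × ¬ (sC (αP h) ∈λ λ′)
  × ¬ (eC (ωP h) ∈λ λ′)
  × All (λ u → ¬ (eC (sC u) ∈λ λ′)) (pathCells h)

open DecMem _≟ᶜ_ using (_∈?_)

addCells : Filling → List Cell → Filling
addCells π ps u = if does (u ∈? ps) then suc (π u) else π u

Compatible : List ℕ → Path → Filling → Set
Compatible λ′ P π =
  (∀ u → u ∈ pathCells P → (inIᵇ λ′ u ∨ inAᵇ λ′ u) ≡ true →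
     eC u ∈ pathCells P × π u ≡ π (eC u))
  × (∀ u → u ∈ pathCells P → sC u ∈ pathCells P → π u ≡ π (sC u))

Inserts : List ℕ → Path → Filling → Set
Inserts λ′ h π = ∃[ P ] IsNEPath λ′ P × ωP P ≡ ωP h × lenP P ≡ lenP h
  × Compatible λ′ P π × IsRPP λ′ (addCells π (pathCells P))

-- the south-west path P(h, π): starting at the current cell u with k steps
-- remaining, go to s u if u ∈ 𝓑 ∪ 𝓘 and π(u) = π(s u) (π(s u) = ∞ when
-- s u ∉ λ), else to w u.
swPath : List ℕ → Filling → ℕ → Cell → List Cell
swPath λ′ π zero u = u ∷ []
swPath λ′ π (suc k) u =
  u ∷ swPath λ′ π k
    (if (inBᵇ λ′ u ∨ inIᵇ λ′ u) ∧ inλᵇ λ′ (sC u) ∧ does (π u ℕ.≟ π (sC u))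
     then sC u else wC u)

insertHook : List ℕ → Path → Filling → Filling
insertHook λ′ h π = addCells π (swPath λ′ π (lenP h) (ωP h))

insertAll : List ℕ → List Path → Filling → Filling
insertAll λ′ [] π = π
insertAll λ′ (h ∷ hs) π = insertAll λ′ hs (insertHook λ′ h π)

AllInsert : List ℕ → List Path → Filling → Set
AllInsert λ′ [] π = ⊤
AllInsert λ′ (h ∷ hs) π = Inserts λ′ h π × AllInsert λ′ hs (insertHook λ′ h π)

{-# OPTIONS --safe #-}
-- Let ε(c) say whether the boundary strip of λ, read from south-west to
-- north-east, leaves content c by an east step.  On contents, 𝓘 ∪ 𝓐 is where
-- ε(c) holds and 𝓑 ∪ 𝓘 is where ε(c − 1) fails.
--
-- Call v ∈ λ a candidate of π if ε(c(v) − 1) holds and π(w v) < π(v).  If there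
-- is none then π = 0, diagonal by diagonal.  Otherwise start at a candidate α of
-- maximal content and walk: north if π(n u) = π(u), else east, until λ ends.
-- Along the walk π(n w u) < π(u).  Hence where ε(c(u)) holds the walk goes east
-- and π(u) = π(e u), for otherwise n u or e u would be a candidate of larger
-- content.  Lowering π by 1 on the walk P gives a reverse plane partition σ with
-- (P, σ) compatible; the south-west insertion path retraces P, and projecting P
-- along diagonals to the boundary strip gives the rim-hook h with π = h * σ.
module Submission where

open import Defs
open import Data.Bool using (Bool; true; false; _∧_; _∨_; if_then_else_)
import Data.Bool as Bool
open import Data.Bool.ListAction using (any)
import Data.Bool.Properties as BoolP
open import Data.Integer as ℤ using (ℤ; +_; -[1+_])
import Data.Integer.Properties as ℤP
open import Data.Integer.Tactic.RingSolver using (solve-∀)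
open import Data.List using (List; []; _∷_; map; filter; zip; length; applyUpTo; _∷ʳ_; _ʳ++_; reverse)
open import Data.List.Membership.Propositional using (_∈_)
open import Data.List.Membership.Propositional.Properties using (∈-map⁺; ∈-map⁻; ∈-++⁺ˡ; ∈-++⁺ʳ; ∈-++⁻; ∈-applyUpTo⁺; ∈-applyUpTo⁻; ∈-filter⁺; ∈-filter⁻)
open import Data.List.Membership.Propositional.Properties.WithK using (unique∧set⇒bag)
import Data.List.Membership.DecPropositional as DecMem
open import Data.List.Properties using (length-map)
open import Data.List.Relation.Binary.BagAndSetEquality using (∼bag⇒↭)
open import Data.List.Relation.Binary.Permutation.Propositional using (↭-trans; ↭⇒↭ₛ)
open import Data.List.Relation.Binary.Pointwise using (Pointwise-≡⇒≡)
open import Data.List.Relation.Unary.All as All using (All; []; _∷_)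
import Data.List.Relation.Unary.All.Properties as AllP
open import Data.List.Relation.Unary.AllPairs as AllPairs using (AllPairs; []; _∷_)
import Data.List.Relation.Unary.AllPairs.Properties as AllPairsP
open import Data.List.Relation.Unary.Any using (here; there)
import Data.List.Relation.Unary.Any.Properties as AnyP
open import Data.List.Relation.Unary.Linked using (Linked; [-]; _∷_)
import Data.List.Relation.Unary.Linked.Properties as LinkedP
open import Data.List.Relation.Unary.Sorted.TotalOrder.Properties using (↗↭↗⇒≋)
open import Data.List.Relation.Unary.Unique.Propositional using (Unique)
import Data.List.Relation.Unary.Unique.Propositional.Properties as UniqueP
open import Data.List.Sort.Base using (SortingAlgorithm)
open import Data.List.Sort.MergeSort ℤP.≤-decTotalOrder using (mergeSort)
open import Data.Nat as ℕ using (ℕ; zero; suc; _≤_; _<_; z≤n; s≤s)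
open import Data.Nat.Induction using (Acc; acc; <-wellFounded)
open import Data.Nat.ListAction using (sum)
import Data.Nat.Properties as ℕP
open import Data.Product using (_×_; _,_; ∃-syntax; proj₁; proj₂)
open import Data.Sum as Sum using (_⊎_; inj₁; inj₂)
open import Data.Unit using (tt)
open import Function using (_∘_; mk⇔)
open import Relation.Binary using (tri<; tri≈; tri>)
open import Relation.Binary.PropositionalEquality using (_≡_; _≢_; refl; sym; trans; cong; cong₂; subst; subst₂)
open import Relation.Nullary using (¬_; Dec; does; yes; no; contradiction)
open import Relation.Nullary.Decidable using (dec-true; dec-false; _×-dec_)
open import Relation.Unary using (Decidable)

open DecMem _≟ᶜ_ using (_∈?_)

-- Booleans, integer successors and ranges.

does-true⁻ : ∀ {a} {P : Set a} (d : Dec P) → does d ≡ true → P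
does-true⁻ (yes p) _ = p

true≢false : ∀ {b} → b ≡ true → b ≢ false
true≢false refl ()

∧-true⁻ : ∀ a {b} → a ∧ b ≡ true → a ≡ true × b ≡ true
∧-true⁻ true eq = refl , eq

∨-true⁻ : ∀ a {b} → a ∨ b ≡ true → a ≡ true ⊎ b ≡ true
∨-true⁻ true  _  = inj₁ refl
∨-true⁻ false eq = inj₂ eq

∨-trueˡ : ∀ {a b} → a ≡ true → a ∨ b ≡ true
∨-trueˡ refl = refl

∨-trueʳ : ∀ a {b} → b ≡ true → a ∨ b ≡ true
∨-trueʳ a refl = BoolP.∨-zeroʳ a

not-true⁻ : ∀ {b} → not b ≡ true → b ≡ false
not-true⁻ {false} _ = refl

¬true⇒false : ∀ {b} → ¬ b ≡ true → b ≡ false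
¬true⇒false = BoolP.¬-not

i<suc[i] : ∀ i → i ℤ.< ℤ.suc i
i<suc[i] i = ℤP.suc[i]≤j⇒i<j ℤP.≤-refl

+-suc-shift : ∀ a b → a ℤ.+ (ℤ.1ℤ ℤ.+ b) ≡ (ℤ.1ℤ ℤ.+ a) ℤ.+ b
+-suc-shift = solve-∀

range : ℤ → ℕ → List ℤ
range p zero    = []
range p (suc n) = p ∷ range (ℤ.suc p) n

between : ℤ → ℤ × ℤ → Bool
between x q = (proj₁ q <ᶻ x) ∧ (x <ᶻ proj₂ q)

-- Turns of a step function against `condA` and `condB`.

-- f is the ε of the header; corners of λ become turns of the step function f.
module Interlacing (f : ℤ → Bool) where

  innerTurnᵇ outerTurnᵇ : ℤ → Bool
  innerTurnᵇ c = f c ∧ not (f (ℤ.pred c))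
  outerTurnᵇ c = not (f c) ∧ f (ℤ.pred c)

  innerTurns outerTurns : ℤ → ℕ → List ℤ
  innerTurns p n = filter (λ c → innerTurnᵇ c Bool.≟ true) (range p n)
  outerTurns p n = filter (λ c → outerTurnᵇ c Bool.≟ true) (range p n)

  private
    f-pred-suc : ∀ {b} p → f p ≡ b → f (ℤ.pred (ℤ.suc p)) ≡ b
    f-pred-suc p = trans (cong f (ℤP.pred-suc p))

    shift : ∀ {x} p n → x ℤ.< p ℤ.+ + suc n → x ℤ.< ℤ.suc p ℤ.+ + n
    shift {x} p n = subst (x ℤ.<_) (+-suc-shift p (+ n))

    suc≤ : ∀ {p x} → p ℤ.≤ x → p ≢ x → ℤ.suc p ℤ.≤ x
    suc≤ p≤x p≢x = ℤP.i<j⇒suc[i]≤j (ℤP.≤∧≢⇒< p≤x p≢x)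

  between-innerTurns⇒< : ∀ p n x os →
    any (between x) (zip (innerTurns p n) os) ≡ true → p ℤ.< x
  between-innerTurns⇒< p (suc n) x os h with innerTurnᵇ p
  ... | false = ℤP.<-trans (i<suc[i] p) (between-innerTurns⇒< (ℤ.suc p) n x os h)
  between-innerTurns⇒< p (suc n) x (o ∷ os) h | true with ∨-true⁻ (between x (p , o)) h
  ... | inj₁ b = does-true⁻ (p ℤ.<? x) (proj₁ (∧-true⁻ (p <ᶻ x) b))
  ... | inj₂ r = ℤP.<-trans (i<suc[i] p) (between-innerTurns⇒< (ℤ.suc p) n x os r)

  mutual
    -- The scan remembers the last step. After an east step the next turn is an outer one, so both
    -- lists of turns restart at the same index and the condition keeps its form. At an outer turn
    -- p, p ≤ x excludes x < p, which leaves the pairing of inner turns with later outer turns.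
    condA⇒east : ∀ p n x → f (ℤ.pred p) ≡ true → p ℤ.≤ x →
      condA x (outerTurns p n) (innerTurns p n) ≡ true → f x ≡ true
    condA⇒east p (suc n) x fp′ p≤x h with f p in fp
    ... | true rewrite fp′ with p ℤ.≟ x
    ...   | yes refl = fp
    ...   | no p≢x   = condA⇒east (ℤ.suc p) n x (f-pred-suc p fp) (suc≤ p≤x p≢x) h
    condA⇒east p (suc n) x fp′ p≤x h | false rewrite fp′ with ∨-true⁻ (x <ᶻ p) h
    ... | inj₁ x<p = contradiction p≤x (ℤP.<⇒≱ (does-true⁻ (x ℤ.<? p) x<p))
    ... | inj₂ r   = between⇒east (ℤ.suc p) n x (f-pred-suc p fp) r

    -- The complementary state, after a north step: the next turn is an inner one, and an east
    -- stretch begins there.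
    between⇒east : ∀ p n x → f (ℤ.pred p) ≡ false →
      any (between x) (zip (innerTurns p n) (outerTurns p n)) ≡ true → f x ≡ true
    between⇒east p (suc n) x fp′ h with f p in fp
    ... | false rewrite fp′ = between⇒east (ℤ.suc p) n x (f-pred-suc p fp) h
    ... | true rewrite fp′ = step (outerTurns (ℤ.suc p) n) refl h
      where
      -- With no outer turn left the pairing is empty and the hypothesis absurd. Otherwise x lies
      -- before the next outer turn `o` or in a later gap, and both cases restore the hypotheses of
      -- `condA⇒east`.
      step : ∀ os → os ≡ outerTurns (ℤ.suc p) n →
        any (between x) (zip (p ∷ innerTurns (ℤ.suc p) n) os) ≡ true → f x ≡ true
      step (o ∷ os) eq h = condA⇒east (ℤ.suc p) n x (f-pred-suc p fp) (proj₁ split)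
        (trans (cong (λ z → condA x z (innerTurns (ℤ.suc p) n)) (sym eq)) (proj₂ split))
        where
        split : ℤ.suc p ℤ.≤ x × condA x (o ∷ os) (innerTurns (ℤ.suc p) n) ≡ true
        split with ∨-true⁻ (between x (p , o)) h
        ... | inj₁ b with ∧-true⁻ (p <ᶻ x) b
        ...   | p<x , x<o = ℤP.i<j⇒suc[i]≤j (does-true⁻ (p ℤ.<? x) p<x) , ∨-trueˡ x<o
        split | inj₂ r = ℤP.<⇒≤ (between-innerTurns⇒< (ℤ.suc p) n x os r) , ∨-trueʳ (x <ᶻ o) r

  condBI : ℤ → List ℤ → List ℤ → Bool
  condBI x os is = condB x os is ∨ any (x ==ᶻ_) is

  -- A new first pair keeps the matching of outer with inner turns. It also keeps the last outer
  -- turn, unless `os` is empty, and then x can only be an inner turn.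
  condBI-∷ : ∀ x o i os is → condBI x os is ≡ true → condBI x (o ∷ os) (i ∷ is) ≡ true
  condBI-∷ x o i [] is h = ∨-trueʳ (condB x (o ∷ []) (i ∷ is)) (∨-trueʳ (x ==ᶻ i) h)
  condBI-∷ x o i (o′ ∷ os) is h with ∨-true⁻ (condB x (o′ ∷ os) is) h
  ... | inj₂ e = ∨-trueʳ (condB x (o ∷ o′ ∷ os) (i ∷ is)) (∨-trueʳ (x ==ᶻ i) e)
  ... | inj₁ b with ∨-true⁻ (any (between x) (zip (o′ ∷ os) is)) b
  ...   | inj₁ r = ∨-trueˡ (∨-trueˡ (∨-trueʳ (between x (o , i)) r))
  ...   | inj₂ l = ∨-trueˡ (∨-trueʳ (any (between x) (zip (o ∷ o′ ∷ os) (i ∷ is))) l)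

  mutual
    -- x is not p, since p is entered by an east step and x by a north step. So the scan passes p;
    -- if p is an outer turn, it becomes the lower end of a pending 𝓑-interval.
    north⇒condBI : ∀ p n x → f (ℤ.pred p) ≡ true → p ℤ.≤ x → x ℤ.< p ℤ.+ + n →
      f (ℤ.pred x) ≡ false → condBI x (outerTurns p n) (innerTurns p n) ≡ true
    north⇒condBI p zero x fp′ p≤x x<p+n fx =
      contradiction p≤x (ℤP.<⇒≱ (subst (x ℤ.<_) (ℤP.+-identityʳ p) x<p+n))
    north⇒condBI p (suc n) x fp′ p≤x x<p+n fx with p ℤ.≟ x
    ... | yes refl = contradiction fx (true≢false fp′)
    ... | no p≢x with f p in fp
    ...   | true rewrite fp′ =
      north⇒condBI (ℤ.suc p) n x (f-pred-suc p fp) (suc≤ p≤x p≢x) (shift p n x<p+n) fx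
    ...   | false rewrite fp′ =
      north⇒condBI′ p (ℤ.suc p) n x (f-pred-suc p fp) (ℤP.≤∧≢⇒< p≤x p≢x) (shift p n x<p+n) (inj₂ fx)

    -- A stretch of north steps that began at the outer corner o.
    north⇒condBI′ : ∀ o p n x → f (ℤ.pred p) ≡ false → o ℤ.< x → x ℤ.< p ℤ.+ + n →
      x ℤ.< p ⊎ f (ℤ.pred x) ≡ false →
      condBI x (o ∷ outerTurns p n) (innerTurns p n) ≡ true
    north⇒condBI′ o p zero x fp′ o<x x<p+n fx = ∨-trueˡ (dec-true (o ℤ.<? x) o<x)
    north⇒condBI′ o p (suc n) x fp′ o<x x<p+n fx with f p in fp
    ... | false rewrite fp′ = north⇒condBI′ o (ℤ.suc p) n x (f-pred-suc p fp) o<x (shift p n x<p+n)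
                    (Sum.map₁ (λ x<p → ℤP.<-trans x<p (i<suc[i] p)) fx)
    ... | true rewrite fp′ with ℤP.<-cmp x p
    ...   | tri< x<p _ _ = ∨-trueˡ (∨-trueˡ (∨-trueˡ
                             (cong₂ _∧_ (dec-true (o ℤ.<? x) o<x) (dec-true (x ℤ.<? p) x<p))))
    ...   | tri≈ _ refl _ = ∨-trueʳ (condB x (o ∷ outerTurns (ℤ.suc p) n) (p ∷ innerTurns (ℤ.suc p) n))
                             (∨-trueˡ (dec-true (x ℤ.≟ p) refl))
    ...   | tri> x≮p _ p<x with fx
    ...     | inj₁ x<p = contradiction x<p x≮p
    ...     | inj₂ fx′ = condBI-∷ x o p (outerTurns (ℤ.suc p) n) (innerTurns (ℤ.suc p) n)
                          (north⇒condBI (ℤ.suc p) n x (f-pred-suc p fp) (ℤP.i<j⇒suc[i]≤j p<x)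
                            (shift p n x<p+n) fx′)

-- Sorted lists and ranges of contents.

sortℤ-unique : ∀ {xs ys} → Unique xs → AllPairs ℤ._<_ ys →
  (∀ {c} → c ∈ xs → c ∈ ys) → (∀ {c} → c ∈ ys → c ∈ xs) → sortℤ xs ≡ ys
sortℤ-unique {xs} xs! ys< to from = Pointwise-≡⇒≡ (↗↭↗⇒≋ ℤP.≤-totalOrder
  (SortingAlgorithm.sort-↗ mergeSort xs)
  (LinkedP.AllPairs⇒Linked (AllPairs.map ℤP.<⇒≤ ys<))
  (↭⇒↭ₛ (↭-trans (SortingAlgorithm.sort-↭ mergeSort xs)
    -- Without repetitions, equal sets are equal bags and hence permutations of each other;
    -- sortedness then fixes the list.
    (∼bag⇒↭ (unique∧set⇒bag xs! (AllPairs.map ℤP.<⇒≢ ys<) (mk⇔ to from))))))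

∈-range⁻ : ∀ {c} p n → c ∈ range p n → p ℤ.≤ c
∈-range⁻ p (suc n) (here refl) = ℤP.≤-refl
∈-range⁻ p (suc n) (there c∈)  = ℤP.≤-trans (ℤP.i≤suc[i] p) (∈-range⁻ (ℤ.suc p) n c∈)

∈-range⁻-< : ∀ {c} p n → c ∈ range p n → c ℤ.< p ℤ.+ + n
∈-range⁻-< p (suc n) (here refl) = subst (p ℤ.<_) (sym (+-suc-shift p (+ n)))
  (ℤP.<-≤-trans (i<suc[i] p) (ℤP.i≤i+j (ℤ.suc p) (+ n)))
∈-range⁻-< {c} p (suc n) (there c∈) = subst (c ℤ.<_) (sym (+-suc-shift p (+ n))) (∈-range⁻-< (ℤ.suc p) n c∈)

∈-range⁺ : ∀ {c} p n → p ℤ.≤ c → c ℤ.< p ℤ.+ + n → c ∈ range p n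
∈-range⁺ {c} p zero p≤c c<p+0 = contradiction p≤c (ℤP.<⇒≱ (subst (c ℤ.<_) (ℤP.+-identityʳ p) c<p+0))
∈-range⁺ {c} p (suc n) p≤c c<p+n with p ℤ.≟ c
... | yes refl = here refl
... | no p≢c   = there (∈-range⁺ (ℤ.suc p) n (ℤP.i<j⇒suc[i]≤j (ℤP.≤∧≢⇒< p≤c p≢c))
                   (subst (c ℤ.<_) (+-suc-shift p (+ n)) c<p+n))

range-< : ∀ p n → AllPairs ℤ._<_ (range p n)
range-< p zero    = []
range-< p (suc n) = All.tabulate (λ c∈ → ℤP.<-≤-trans (i<suc[i] p) (∈-range⁻ (ℤ.suc p) n c∈)) ∷ range-< (ℤ.suc p) n

-- Contents of neighbouring cells.

content-e : ∀ i j → content (i , suc j) ≡ ℤ.suc (content (i , j))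
content-e i j = lemma (+ j) (+ i)
  where
  lemma : ∀ x y → (ℤ.1ℤ ℤ.+ x) ℤ.+ (ℤ.- y) ≡ ℤ.1ℤ ℤ.+ (x ℤ.+ (ℤ.- y))
  lemma = solve-∀

content-s : ∀ i j → content (i , j) ≡ ℤ.suc (content (suc i , j))
content-s i j = lemma (+ j) (+ i)
  where
  lemma : ∀ x y → x ℤ.+ (ℤ.- y) ≡ ℤ.1ℤ ℤ.+ (x ℤ.+ (ℤ.- (ℤ.1ℤ ℤ.+ y)))
  lemma = solve-∀

content-es : ∀ i j → content (suc i , suc j) ≡ content (i , j)
content-es i j = trans (content-e (suc i) j) (sym (content-s i j))

content-s-pred : ∀ i j → content (suc i , j) ≡ ℤ.pred (content (i , j))
content-s-pred i j = trans (sym (ℤP.pred-suc _)) (cong ℤ.pred (sym (content-s i j)))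

content-w-pred : ∀ i j → content (i , j) ≡ ℤ.pred (content (i , suc j))
content-w-pred i j = trans (sym (ℤP.pred-suc _)) (cong ℤ.pred (sym (content-e i j)))

private
  content-clear : ∀ i j a → content (i , j) ℤ.+ (+ i ℤ.+ + a) ≡ + (j ℕ.+ a)
  content-clear i j a = lemma (+ j) (+ i) (+ a)
    where
    lemma : ∀ x y z → (x ℤ.+ (ℤ.- y)) ℤ.+ (y ℤ.+ z) ≡ x ℤ.+ z
    lemma = solve-∀

content-≡⁻ : ∀ i j a b → content (i , j) ≡ content (a , b) → j ℕ.+ a ≡ b ℕ.+ i
content-≡⁻ i j a b eq = ℤP.+-injective (trans (sym (content-clear i j a))
  (trans (cong₂ ℤ._+_ eq (ℤP.+-comm (+ i) (+ a))) (content-clear a b i)))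

-- Where the diagonal of content c enters the quadrant i, j ≥ 1: in the top row for c ≥ 0, in the
-- first column for c < 0.
start : ℤ → Cell
start (+ n)    = 1 , suc n
start -[1+ n ] = suc (suc n) , 1

content-start : ∀ c → content (start c) ≡ c
content-start (+ n)    = refl
content-start -[1+ n ] = refl

-- Rows and cells of a diagram.

rowLen-step : ∀ {xs} → Decreasing xs → ∀ i → rowLen xs (suc (suc i)) ≤ rowLen xs (suc i)
rowLen-step dec-[]        i       = z≤n
rowLen-step dec-[-]       i       = z≤n
rowLen-step (dec-∷ b≤a d) zero    = b≤a
rowLen-step (dec-∷ b≤a d) (suc i) = rowLen-step d i

rowLen-antitone : ∀ {xs} → Decreasing xs → ∀ {i a} → 1 ≤ i → i ≤ a → rowLen xs a ≤ rowLen xs i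
rowLen-antitone {xs} d {suc i} (s≤s _) i≤a = go (ℕP.≤⇒≤′ i≤a)
  where
  go : ∀ {a} → suc i ℕ.≤′ a → rowLen xs a ≤ rowLen xs (suc i)
  go ℕ.≤′-refl           = ℕP.≤-refl
  go {suc (suc a)} (ℕ.≤′-step i≤a) = ℕP.≤-trans (rowLen-step d a) (go i≤a)
  go {suc zero} (ℕ.≤′-step i≤a) = contradiction (ℕP.≤′⇒≤ i≤a) λ ()

rowLen-pos : ∀ {xs} → All (1 ≤_) xs → ∀ i → i < length xs → 1 ≤ rowLen xs (suc i)
rowLen-pos (1≤r ∷ _)  zero    _         = 1≤r
rowLen-pos (_ ∷ 1≤rs) (suc i) (s≤s i<n) = rowLen-pos 1≤rs i i<n

rowLen-pos⁻ : ∀ xs i → 1 ≤ rowLen xs (suc i) → i < length xs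
rowLen-pos⁻ (r ∷ rs) zero    _  = s≤s z≤n
rowLen-pos⁻ (r ∷ rs) (suc i) 1≤ = s≤s (rowLen-pos⁻ rs i 1≤)

∈λ⁺ : ∀ {xs i j} → 1 ≤ j → j ≤ rowLen xs i → (i , j) ∈λ xs
∈λ⁺ {xs} {i} {j} 1≤j j≤ = cong₂ _∧_ (dec-true (1 ℕ.≤? j) 1≤j) (dec-true (j ℕ.≤? rowLen xs i) j≤)

∈λ⁻ : ∀ {xs i j} → (i , j) ∈λ xs → 1 ≤ i × 1 ≤ j × j ≤ rowLen xs i
∈λ⁻ {xs} {i} {j} u∈ with ∧-true⁻ (does (1 ℕ.≤? j)) u∈
... | 1≤j , j≤ = row i (ℕP.≤-trans 1≤j′ j≤′) , 1≤j′ , j≤′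
  where
  1≤j′ = does-true⁻ (1 ℕ.≤? j) 1≤j
  j≤′  = does-true⁻ (j ℕ.≤? rowLen xs i) j≤
  row : ∀ i → 1 ≤ rowLen xs i → 1 ≤ i
  row (suc i) _ = s≤s z≤n

-- `k` is the number that the first row of `xs` carries in the whole diagram, hence the shift from
-- `suc i` to `k + i`.
∈cellsFrom⁺ : ∀ k xs {i j} → (suc i , j) ∈λ xs → (k ℕ.+ i , j) ∈ cellsFrom k xs
∈cellsFrom⁺ k [] {i} {j} u∈ with ∈λ⁻ {[]} {suc i} {j} u∈
... | _ , 1≤j , j≤0 = contradiction (ℕP.≤-trans 1≤j j≤0) λ ()
∈cellsFrom⁺ k (r ∷ rs) {zero} {zero} ()
∈cellsFrom⁺ k (r ∷ rs) {zero} {suc j} u∈ rewrite ℕP.+-identityʳ k =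
  ∈-++⁺ˡ (∈-map⁺ (k ,_) (∈-applyUpTo⁺ suc (proj₂ (proj₂ (∈λ⁻ {r ∷ rs} {1} {suc j} u∈)))))
∈cellsFrom⁺ k (r ∷ rs) {suc i} u∈ rewrite ℕP.+-suc k i =
  ∈-++⁺ʳ (map (k ,_) (applyUpTo suc r)) (∈cellsFrom⁺ (suc k) rs u∈)

∈cellsFrom⁻ : ∀ k xs {u} → u ∈ cellsFrom k xs → ∃[ i ] ∃[ j ] u ≡ (k ℕ.+ i , j) × (suc i , j) ∈λ xs
∈cellsFrom⁻ k (r ∷ rs) u∈ with ∈-++⁻ (map (k ,_) (applyUpTo suc r)) u∈
... | inj₁ u∈row with ∈-map⁻ (k ,_) u∈row
...   | _ , j∈ , refl with ∈-applyUpTo⁻ suc j∈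
...     | j , j<r , refl = zero , suc j , cong (_, suc j) (sym (ℕP.+-identityʳ k)) , ∈λ⁺ {r ∷ rs} {1} (s≤s z≤n) j<r
∈cellsFrom⁻ k (r ∷ rs) u∈ | inj₂ u∈rest with ∈cellsFrom⁻ (suc k) rs u∈rest
... | i , j , refl , u∈λ = suc i , j , cong (_, j) (sym (ℕP.+-suc k i)) , u∈λ

∈cells⁺ : ∀ {xs u} → u ∈λ xs → u ∈ cells xs
∈cells⁺ {xs} {zero , j} u∈ = contradiction (proj₁ (∈λ⁻ {xs} {zero} {j} u∈)) λ ()
∈cells⁺ {xs} {suc i , j} u∈ = ∈cellsFrom⁺ 1 xs u∈

∈cells⁻ : ∀ {xs u} → u ∈ cells xs → u ∈λ xs
∈cells⁻ {xs} u∈ with ∈cellsFrom⁻ 1 xs u∈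
... | _ , _ , refl , u∈λ = u∈λ

cellsFrom-unique : ∀ k xs → Unique (cellsFrom k xs)
cellsFrom-unique k []       = []
cellsFrom-unique k (r ∷ rs) = UniqueP.++⁺
  (UniqueP.map⁺ (cong proj₂) (UniqueP.applyUpTo⁺₁ suc r (λ i<j _ eq → ℕP.<⇒≢ i<j (ℕP.suc-injective eq))))
  (cellsFrom-unique (suc k) rs)
  (λ { (∈row , ∈rest) → disjoint ∈row ∈rest })
  where
  disjoint : ∀ {u} → u ∈ map (k ,_) (applyUpTo suc r) → ¬ u ∈ cellsFrom (suc k) rs
  disjoint ∈row ∈rest with ∈-map⁻ (k ,_) ∈row | ∈cellsFrom⁻ (suc k) rs ∈rest
  ... | _ , _ , refl | i , _ , eq , _ = ℕP.m≢1+m+n k (cong proj₁ eq)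

-- The boundary strip.

module Shape (λ′ : List ℕ) (partition : IsPartition λ′) where

  In : Cell → Set
  In u = u ∈λ λ′

  ℓ : ℕ
  ℓ = length λ′

  -- One below 1 - ℓ, the content of the bottom cell (ℓ, 1) of a nonempty λ.
  lowest : ℤ
  lowest = ℤ.- + ℓ

  in-north-west : ∀ {i j} a b → In (a , b) → 1 ≤ i → i ≤ a → 1 ≤ j → j ≤ b → In (i , j)
  in-north-west {i} {j} a b u∈ 1≤i i≤a 1≤j j≤b = ∈λ⁺ {λ′} {i} {j} 1≤j
    (ℕP.≤-trans j≤b (ℕP.≤-trans (proj₂ (proj₂ (∈λ⁻ {λ′} {a} {b} u∈)))
      (rowLen-antitone (proj₁ partition) 1≤i i≤a)))

  row≥1 : ∀ i j → In (i , j) → 1 ≤ i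
  row≥1 i j u∈ = proj₁ (∈λ⁻ {λ′} {i} {j} u∈)

  column≥1 : ∀ i j → In (i , j) → 1 ≤ j
  column≥1 i j u∈ = proj₁ (proj₂ (∈λ⁻ {λ′} {i} {j} u∈))

  row≤ℓ : ∀ i j → In (i , j) → i ≤ ℓ
  row≤ℓ zero    j u∈ = z≤n
  row≤ℓ (suc i) j u∈ with ∈λ⁻ {λ′} {suc i} {j} u∈
  ... | _ , 1≤j , j≤ = rowLen-pos⁻ λ′ i (ℕP.≤-trans 1≤j j≤)

  lowest<content : ∀ u → In u → lowest ℤ.< content u
  lowest<content (i , j) u∈ with ∈λ⁻ {λ′} {i} {j} u∈
  lowest<content (suc i , suc j) u∈ | _ , _ , j≤ = ℤP.≤-<-trans
    (ℤP.neg-mono-≤ (ℤ.+≤+ (rowLen-pos⁻ λ′ i (ℕP.≤-trans (s≤s z≤n) j≤))))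
    (subst (-[1+ i ] ℤ.<_) (sym (ℤP.[1+m]⊖[1+n]≡m⊖n j i)) (ℤP.-1+m<n⊖m i j))

  content<rowLen : ∀ u → In u → content u ℤ.< + rowLen λ′ 1
  content<rowLen (i , j) u∈ with ∈λ⁻ {λ′} {i} {j} u∈
  content<rowLen (suc i , j) u∈ | _ , _ , j≤ = ℤP.<-≤-trans (ℤP.m⊖1+n<m j (suc i))
    (ℤ.+≤+ (ℕP.≤-trans j≤ (rowLen-antitone (proj₁ partition) (s≤s z≤n) (s≤s z≤n))))

  start-in : ∀ {c} → lowest ℤ.< c → c ℤ.< + rowLen λ′ 1 → In (start c)
  start-in {+ n} _ (ℤ.+<+ n<) = ∈λ⁺ {λ′} {1} (s≤s z≤n) n<
  -- A diagonal of negative content starts in the first column, which reaches row ℓ because all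
  -- parts are positive.
  start-in { -[1+ n ] } ℓ<c _ with ℤP.neg-cancel-< {+ ℓ} {+ suc n} ℓ<c
  ... | ℤ.+<+ n<ℓ = ∈λ⁺ {λ′} {suc (suc n)} {1} (s≤s z≤n) (rowLen-pos (proj₂ partition) (suc n) n<ℓ)

  Rim : Cell → Set
  Rim r = In r × ¬ In (eC (sC r))

  -- The first argument is fuel for the slide down the diagonal: from row i, ℓ - i moves suffice, as
  -- λ has no row below ℓ.
  rimFrom : ℕ → Cell → Cell
  rimFrom zero    u = u
  rimFrom (suc k) u = if inλᵇ λ′ (eC (sC u)) then rimFrom k (eC (sC u)) else u

  rimFrom-rim : ∀ k {u} → In u → ℓ ≤ k ℕ.+ proj₁ u → Rim (rimFrom k u)
  rimFrom-rim zero {i , j} u∈ ℓ≤ = u∈ , λ es∈ → ℕP.<⇒≱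
    (rowLen-pos⁻ λ′ i (ℕP.≤-trans (s≤s z≤n) (proj₂ (proj₂ (∈λ⁻ {λ′} {suc i} {suc j} es∈))))) ℓ≤
  rimFrom-rim (suc k) {i , j} u∈ ℓ≤ with inλᵇ λ′ (suc i , suc j) in eq
  ... | true  = rimFrom-rim k eq (subst (ℓ ≤_) (sym (ℕP.+-suc k i)) ℓ≤)
  ... | false = u∈ , λ es∈ → true≢false es∈ eq

  rimFrom-content : ∀ k u → content (rimFrom k u) ≡ content u
  rimFrom-content zero    u       = refl
  rimFrom-content (suc k) (i , j) with inλᵇ λ′ (suc i , suc j)
  ... | true  = trans (rimFrom-content k (suc i , suc j)) (content-es i j)
  ... | false = refl

  rim : ℤ → Cell
  rim c = rimFrom ℓ (start c)

  rim-rim : ∀ {c} → lowest ℤ.< c → c ℤ.< + rowLen λ′ 1 → Rim (rim c)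
  rim-rim ℓ<c c< = rimFrom-rim ℓ (start-in ℓ<c c<) (ℕP.m≤m+n ℓ _)

  rim-content : ∀ c → content (rim c) ≡ c
  rim-content c = trans (rimFrom-content ℓ (start c)) (content-start c)

  rim-of-cell : ∀ u → In u → Rim (rim (content u))
  rim-of-cell u u∈ = rim-rim (lowest<content u u∈) (content<rowLen u u∈)

  -- Contents are compared without subtraction, see content-≡⁻.
  rim-south-east : ∀ i j a b → In (i , j) → Rim (a , b) → j ℕ.+ a ≡ b ℕ.+ i → i ≤ a
  rim-south-east i j a b u∈ (r∈ , es∉) eq with i ℕ.≤? a
  ... | yes i≤a = i≤a
  ... | no i≰a  = contradiction
    (in-north-west i j u∈ (s≤s z≤n) (ℕP.≰⇒> i≰a) (s≤s z≤n)
      (ℕP.+-cancelʳ-< a b j (subst (b ℕ.+ a <_) (sym eq) (ℕP.+-monoʳ-< b (ℕP.≰⇒> i≰a))))) es∉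

  rim-unique : ∀ r r′ → Rim r → Rim r′ → content r ≡ content r′ → r ≡ r′
  rim-unique (i , j) (a , b) R R′ c≡ with content-≡⁻ i j a b c≡
  ... | eq with ℕP.≤-antisym (rim-south-east i j a b (proj₁ R) R′ eq) (rim-south-east a b i j (proj₁ R′) R (sym eq))
  ...   | refl = cong (i ,_) (ℕP.+-cancelʳ-≡ i j b eq)

  rim-fixed : ∀ r → Rim r → rim (content r) ≡ r
  rim-fixed r R = rim-unique (rim (content r)) r (rim-of-cell r (proj₁ R)) R (rim-content _)

  -- Contents below the diagram count as east steps, so that the first turn
  -- of the boundary is an outer one.
  east : ℤ → Bool
  east c = does (c ℤ.≤? lowest) ∨ inλᵇ λ′ (eC (rim c))

  east-≤ : ∀ {c} → c ℤ.≤ lowest → east c ≡ true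
  east-≤ {c} c≤ = ∨-trueˡ (dec-true (c ℤ.≤? lowest) c≤)

  east-> : ∀ {c} → lowest ℤ.< c → east c ≡ inλᵇ λ′ (eC (rim c))
  east-> {c} <c = cong (_∨ inλᵇ λ′ (eC (rim c))) (dec-false (c ℤ.≤? lowest) (ℤP.<⇒≱ <c))

  east-rim : ∀ r → Rim r → east (content r) ≡ inλᵇ λ′ (eC r)
  east-rim r R = trans (east-> (lowest<content r (proj₁ R))) (cong (inλᵇ λ′ ∘ eC) (rim-fixed r R))

  -- u lies weakly north-west of the strip cell r of its diagonal, so e u lies weakly north-west of
  -- e r.
  east⇒in-e : ∀ u → In u → east (content u) ≡ true → In (eC u)
  east⇒in-e u@(i , j) u∈ h with rim (content u) | rim-of-cell u u∈
                                | rim-content (content u) | trans (sym (east-> (lowest<content u u∈))) h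
  ... | a , b | R | c≡ | er∈ with content-≡⁻ i j a b (sym c≡)
  ...   | eq with rim-south-east i j a b u∈ R eq
  ...     | i≤a = in-north-west a (suc b) er∈ (row≥1 i j u∈) i≤a (s≤s z≤n)
                    (s≤s (ℕP.+-cancelʳ-≤ a j b (subst (_≤ b ℕ.+ a) (sym eq) (ℕP.+-monoʳ-≤ b i≤a))))

  -- Let r be the strip cell on the diagonal of s v. If s v is weakly above r, it lies in λ.
  -- Otherwise e r lies on the diagonal of v, weakly above v, so e r ∈ λ and the boundary would step
  -- east at r.
  ¬east⇒in-s : ∀ v → In v → east (ℤ.pred (content v)) ≡ false → In (sC v)
  ¬east⇒in-s v@(i , j) v∈ h with lowest ℤ.<? ℤ.pred (content v)
  ... | no ≮ = contradiction h (true≢false (east-≤ (ℤP.≮⇒≥ ≮)))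
  ... | yes <c with rim (ℤ.pred (content v))
                  | rim-rim <c (ℤP.<-trans (ℤP.i≤pred[j]⇒i<j ℤP.≤-refl) (content<rowLen v v∈))
                  | rim-content (ℤ.pred (content v)) | trans (sym (east-> <c)) h
  ...   | a , b | R | c≡ | er∉ with content-≡⁻ (suc i) j a b (trans (content-s-pred i j) (sym c≡))
  ...     | eq with suc i ℕ.≤? a
  ...       | yes i<a = in-north-west a b (proj₁ R) (s≤s z≤n) i<a (column≥1 i j v∈)
                          (ℕP.+-cancelʳ-≤ a j b (subst (_≤ b ℕ.+ a) (sym eq) (ℕP.+-monoʳ-≤ b i<a)))
  ...       | no i≮a = contradiction er∉ (true≢false
                         (in-north-west i j v∈ (row≥1 a b (proj₁ R)) a≤i (s≤s z≤n)
                           (ℕP.+-cancelʳ-≤ a (suc b) j (subst (suc b ℕ.+ a ≤_) (trans (sym (ℕP.+-suc b i)) (sym eq))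
                              (ℕP.+-monoʳ-≤ (suc b) a≤i)))))
    where a≤i = ℕP.≮⇒≥ i≮a

  rim-s : ∀ r → Rim r → In (sC r) → Rim (sC r)
  rim-s (a , b) (r∈ , es∉) s∈ = s∈ , λ ess∈ → es∉ (in-north-west _ _ ess∈ (s≤s z≤n) (ℕP.n≤1+n _) (s≤s z≤n) ℕP.≤-refl)

  -- s r is again on the strip, and its east neighbour es r is outside λ.
  in-s⇒¬east : ∀ r → Rim r → In (sC r) → east (ℤ.pred (content r)) ≡ false
  in-s⇒¬east (a , b) R s∈ = trans (cong east (sym (content-s-pred a b)))
    (trans (east-rim (suc a , b) (rim-s (a , b) R s∈)) (¬true⇒false (proj₂ R)))

  next-of-first-row : ∀ i j b → In (i , j) → content (i , j) ≡ ℤ.suc (content (1 , b)) → suc b ≤ j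
  next-of-first-row i j b v∈ cv = ℕP.+-cancelʳ-≤ 1 (suc b) j
    (subst (suc b ℕ.+ 1 ≤_) (sym (content-≡⁻ i j 1 (suc b) (trans cv (sym (content-e 1 b)))))
      (ℕP.+-monoʳ-≤ (suc b) (row≥1 i j v∈)))

  -- The next strip cell is e r if that lies in λ, else n r. In the top row the second case cannot
  -- occur: v has content one larger than r, so its column is beyond that of r, which forces e r ∈
  -- λ.
  rim-next : ∀ r v → Rim r → In v → content v ≡ ℤ.suc (content r) → NEStep r (rim (content v))
  rim-next (a , b) v R v∈ cv with inλᵇ λ′ (a , suc b) in eq
  ... | true = inj₂ (trans (cong rim (trans cv (sym (content-e a b)))) (rim-fixed (a , suc b)
    (eq , λ ese∈ → proj₂ R (in-north-west _ _ ese∈ (s≤s z≤n) ℕP.≤-refl (s≤s z≤n) (ℕP.n≤1+n _)))))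
  rim-next (zero , b) v R v∈ cv | false = contradiction (row≥1 zero b (proj₁ R)) λ ()
  rim-next (suc zero , b) (i , j) R v∈ cv | false = contradiction eq (true≢false
    (in-north-west i j v∈ (s≤s z≤n) (row≥1 i j v∈) (s≤s z≤n) (next-of-first-row i j b v∈ cv)))
  rim-next (suc (suc a) , b) v R v∈ cv | false =
    inj₁ (trans (cong rim (trans cv (sym (content-s (suc a) b)))) (rim-fixed (suc a , b)
      (in-north-west (suc (suc a)) b (proj₁ R) (s≤s z≤n) (ℕP.n≤1+n _) (column≥1 (suc (suc a)) b (proj₁ R)) ℕP.≤-refl
      , λ e∈ → true≢false e∈ eq)))

  -- Corner contents as turns of the boundary.

  open Interlacing east public

  -- The number of contents from -ℓ up to λ₁ - 1: those of the cells, and `lowest`.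
  boundary : ℕ
  boundary = ℓ ℕ.+ rowLen λ′ 1

  private
    lowest+boundary : lowest ℤ.+ + boundary ≡ + rowLen λ′ 1
    lowest+boundary = lemma (+ ℓ) (+ rowLen λ′ 1)
      where
      lemma : ∀ x y → (ℤ.- x) ℤ.+ (x ℤ.+ y) ≡ y
      lemma = solve-∀

    content∈range : ∀ u → In u → content u ∈ range lowest boundary
    content∈range u u∈ = ∈-range⁺ lowest boundary (ℤP.<⇒≤ (lowest<content u u∈))
      (subst (content u ℤ.<_) (sym lowest+boundary) (content<rowLen u u∈))

    -- The content `lowest` lies in the range but carries no cell; it is not a turn.
    rim∈ : ∀ {c} → c ∈ range lowest boundary → ¬ (east c ≡ true × east (ℤ.pred c) ≡ true) → Rim (rim c)
    rim∈ {c} c∈ turn with lowest ℤ.<? c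
    ... | yes <c = rim-rim <c (subst (c ℤ.<_) lowest+boundary (∈-range⁻-< lowest boundary c∈))
    ... | no ≮c  = contradiction (east-≤ c≤ , east-≤ (ℤP.≤-trans (ℤP.i≤j⇒pred[i]≤j ℤP.≤-refl) c≤)) turn
      where c≤ = ℤP.≮⇒≥ ≮c

    -- Corners lie on the strip, where the content determines the cell. So the corner contents are
    -- distinct, and sorting them yields the turns in the increasing order of `range`.
    corners-sorted : (cornerᵇ : Cell → Bool) (turnᵇ : ℤ → Bool) →
      (∀ u → In u → cornerᵇ u ≡ true → Rim u × turnᵇ (content u) ≡ true) →
      (∀ c → c ∈ range lowest boundary → turnᵇ c ≡ true → Rim (rim c) × cornerᵇ (rim c) ≡ true) →
      sortℤ (map content (filter (λ u → cornerᵇ u Bool.≟ true) (cells λ′)))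
        ≡ filter (λ c → turnᵇ c Bool.≟ true) (range lowest boundary)
    corners-sorted cornerᵇ turnᵇ corner⇒turn turn⇒corner = sortℤ-unique
      (AllPairsP.map⁺ (distinct (cells λ′) (cellsFrom-unique 1 λ′) (λ u∈ → ∈cells⁻ u∈)))
      (AllPairsP.filter⁺ turn? (range-< lowest boundary))
      to from
      where
      corner? = λ u → cornerᵇ u Bool.≟ true
      turn?   = λ c → turnᵇ c Bool.≟ true

      distinct : ∀ us → Unique us → (∀ {u} → u ∈ us → In u) →
        AllPairs (λ u v → content u ≢ content v) (filter corner? us)
      distinct [] _ _ = []
      distinct (u ∷ us) (u∉ ∷ us!) ∈λ with cornerᵇ u in eq
      ... | false = distinct us us! (∈λ ∘ there)
      ... | true  = All.tabulate (λ {v} v∈ c≡ → let v∈us , vcorner = ∈-filter⁻ corner? v∈ in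
                      All.lookup u∉ v∈us (rim-unique u v (proj₁ (corner⇒turn u (∈λ (here refl)) eq))
                        (proj₁ (corner⇒turn v (∈λ (there v∈us)) vcorner)) c≡))
                    ∷ distinct us us! (∈λ ∘ there)

      to : ∀ {c} → c ∈ map content (filter corner? (cells λ′)) → c ∈ filter turn? (range lowest boundary)
      to c∈ with ∈-map⁻ content c∈
      ... | u , u∈ , refl with ∈-filter⁻ corner? {xs = cells λ′} u∈
      ...   | u∈cells , corner = ∈-filter⁺ turn? (content∈range u (∈cells⁻ u∈cells))
                                   (proj₂ (corner⇒turn u (∈cells⁻ u∈cells) corner))

      from : ∀ {c} → c ∈ filter turn? (range lowest boundary) → c ∈ map content (filter corner? (cells λ′))
      from {c} c∈ with ∈-filter⁻ turn? {xs = range lowest boundary} c∈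
      ... | c∈range , turn with turn⇒corner c c∈range turn
      ...   | R , corner = subst (_∈ map content (filter corner? (cells λ′))) (rim-content c)
                             (∈-map⁺ content (∈-filter⁺ corner? (∈cells⁺ (proj₁ R)) corner))

    inner⇒turn : ∀ u → In u → isInnerCornerᵇ λ′ u ≡ true → Rim u × innerTurnᵇ (content u) ≡ true
    inner⇒turn u u∈ h with ∧-true⁻ (inλᵇ λ′ (eC u)) h
    ... | e∈ , h′ with ∧-true⁻ (inλᵇ λ′ (sC u)) h′
    ...   | s∈ , es∉ = R , cong₂ (λ a b → a ∧ not b) (trans (east-rim u R) e∈) (in-s⇒¬east u R s∈)
      where
      R : Rim u
      R = u∈ , λ es∈ → true≢false es∈ (not-true⁻ es∉)

    turn⇒inner : ∀ c → c ∈ range lowest boundary → innerTurnᵇ c ≡ true → Rim (rim c) × isInnerCornerᵇ λ′ (rim c) ≡ true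
    turn⇒inner c c∈ h with ∧-true⁻ (east c) h
    ... | e , ne = R , cong₂ _∧_ (trans (sym (east-rim r R)) (trans (cong east (rim-content c)) e))
        (cong₂ _∧_ (¬east⇒in-s r (proj₁ R) (trans (cong (east ∘ ℤ.pred) (rim-content c)) (not-true⁻ ne)))
          (cong not (¬true⇒false (proj₂ R))))
      where
      r = rim c
      R : Rim r
      R = rim∈ c∈ λ { (_ , e′) → true≢false e′ (not-true⁻ ne) }

    outer⇒turn : ∀ u → In u → isOuterCornerᵇ λ′ u ≡ true → Rim u × outerTurnᵇ (content u) ≡ true
    outer⇒turn u@(i , j) u∈ h with ∧-true⁻ (inλᵇ λ′ u) h
    ... | _ , h′ with ∧-true⁻ (not (inλᵇ λ′ (eC u))) h′
    ...   | e∉ , s∉ = R , cong₂ (λ a b → not a ∧ b) (trans (east-rim u R) (not-true⁻ e∉)) e-prev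
      where
      R : Rim u
      R = u∈ , λ es∈ → true≢false (in-north-west (suc i) (suc j) es∈ (row≥1 i j u∈) (ℕP.n≤1+n i) (s≤s z≤n) ℕP.≤-refl)
                         (not-true⁻ e∉)
      e-prev : east (ℤ.pred (content u)) ≡ true
      e-prev with east (ℤ.pred (content u)) in eq
      ... | true  = refl
      ... | false = contradiction (not-true⁻ s∉) (true≢false (¬east⇒in-s u u∈ eq))

    turn⇒outer : ∀ c → c ∈ range lowest boundary → outerTurnᵇ c ≡ true → Rim (rim c) × isOuterCornerᵇ λ′ (rim c) ≡ true
    turn⇒outer c c∈ h with ∧-true⁻ (not (east c)) h
    ... | ne , e = R , cong₂ _∧_ (proj₁ R) (cong₂ _∧_
        (cong not (trans (sym (east-rim r R)) (trans (cong east (rim-content c)) (not-true⁻ ne))))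
        (cong not (¬true⇒false λ s∈ → true≢false e
          (trans (cong (east ∘ ℤ.pred) (sym (rim-content c))) (in-s⇒¬east r R s∈)))))
      where
      r = rim c
      R : Rim r
      R = rim∈ c∈ λ { (e′ , _) → true≢false e′ (not-true⁻ ne) }

  innerContents≡ : innerContents λ′ ≡ innerTurns lowest boundary
  innerContents≡ = corners-sorted (isInnerCornerᵇ λ′) innerTurnᵇ inner⇒turn turn⇒inner

  outerContents≡ : outerContents λ′ ≡ outerTurns lowest boundary
  outerContents≡ = corners-sorted (isOuterCornerᵇ λ′) outerTurnᵇ outer⇒turn turn⇒outer

  -- For 𝓘, an inner turn is an east step by definition. For 𝓐, contents up to `lowest` count as
  -- east steps, so the scan of `condA⇒east` can start there.
  I∪A⇒east : ∀ u → (inIᵇ λ′ u ∨ inAᵇ λ′ u) ≡ true → east (content u) ≡ true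
  I∪A⇒east u h = Sum.[ (λ hI → I⇒east (proj₂ (∧-true⁻ (inλᵇ λ′ u) hI)))
                     , (λ hA → A⇒east (proj₁ (∧-true⁻ (inλᵇ λ′ u) hA)) (proj₂ (∧-true⁻ (inλᵇ λ′ u) hA)))
                     ] (∨-true⁻ (inIᵇ λ′ u) h)
    where
    turn : ∀ cs → any (content u ==ᶻ_) (filter (λ c → innerTurnᵇ c Bool.≟ true) cs) ≡ true → east (content u) ≡ true
    turn (c ∷ cs) h with innerTurnᵇ c in eq
    ... | false = turn cs h
    ... | true with ∨-true⁻ (content u ==ᶻ c) h
    ...   | inj₁ e = subst (λ z → east z ≡ true) (sym (does-true⁻ (content u ℤ.≟ c) e)) (proj₁ (∧-true⁻ (east c) eq))
    ...   | inj₂ r = turn cs r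

    I⇒east : any (content u ==ᶻ_) (innerContents λ′) ≡ true → east (content u) ≡ true
    I⇒east = turn (range lowest boundary) ∘ subst (λ is → any (content u ==ᶻ_) is ≡ true) innerContents≡

    A⇒east : In u → condA (content u) (outerContents λ′) (innerContents λ′) ≡ true → east (content u) ≡ true
    A⇒east u∈ = condA⇒east lowest boundary (content u) (east-≤ (ℤP.i≤j⇒pred[i]≤j ℤP.≤-refl))
        (ℤP.<⇒≤ (lowest<content u u∈))
      ∘ subst₂ (λ os is → condA (content u) os is ≡ true) outerContents≡ innerContents≡

  -- Licenses the south moves of the insertion path, which retrace north steps of the walk.
  ¬east⇒B∪I : ∀ v → In v → east (ℤ.pred (content v)) ≡ false → (inBᵇ λ′ v ∨ inIᵇ λ′ v) ≡ true
  ¬east⇒B∪I v v∈ h = guarded v∈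
    (subst₂ (λ os is → condBI (content v) os is ≡ true) (sym outerContents≡) (sym innerContents≡)
      (north⇒condBI lowest boundary (content v) (east-≤ (ℤP.i≤j⇒pred[i]≤j ℤP.≤-refl))
        (ℤP.<⇒≤ (lowest<content v v∈))
        (subst (content v ℤ.<_) (sym lowest+boundary) (content<rowLen v v∈)) h))
    where
    guarded : ∀ {a x y} → a ≡ true → x ∨ y ≡ true → (a ∧ x) ∨ (a ∧ y) ≡ true
    guarded refl eq = eq

-- Maxima, sums and lists of cells.

∃-max-content : ∀ {p} {P : Cell → Set p} → Decidable P → ∀ us →
  (∀ {u} → u ∈ us → ¬ P u) ⊎ (∃[ u ] P u × (∀ {v} → v ∈ us → P v → content v ℤ.≤ content u))
∃-max-content P? [] = inj₁ λ ()
∃-max-content P? (u ∷ us) with P? u | ∃-max-content P? us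
... | no ¬Pu | inj₁ none = inj₁ λ { (here refl) → ¬Pu ; (there v∈) → none v∈ }
... | no ¬Pu | inj₂ (w , Pw , max) =
  inj₂ (w , Pw , λ { (here refl) Pu → contradiction Pu ¬Pu ; (there v∈) → max v∈ })
... | yes Pu | inj₁ none =
  inj₂ (u , Pu , λ { (here refl) _ → ℤP.≤-refl ; (there v∈) Pv → contradiction Pv (none v∈) })
... | yes Pu | inj₂ (w , Pw , max) with ℤP.≤-total (content u) (content w)
...   | inj₁ u≤w = inj₂ (w , Pw , λ { (here refl) _ → u≤w ; (there v∈) → max v∈ })
...   | inj₂ w≤u = inj₂ (u , Pu , λ { (here refl) _ → ℤP.≤-refl ; (there v∈) Pv → ℤP.≤-trans (max v∈ Pv) w≤u })

sum-map-≤ : ∀ {σ π : Filling} us → (∀ u → σ u ≤ π u) → sum (map σ us) ≤ sum (map π us)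
sum-map-≤ []       σ≤π = z≤n
sum-map-≤ (u ∷ us) σ≤π = ℕP.+-mono-≤ (σ≤π u) (sum-map-≤ us σ≤π)

sum-map-< : ∀ {σ π : Filling} {a us} → (∀ u → σ u ≤ π u) → a ∈ us → σ a < π a →
  sum (map σ us) < sum (map π us)
sum-map-< {us = _ ∷ us} σ≤π (here refl) σa<πa = ℕP.+-mono-<-≤ σa<πa (sum-map-≤ us σ≤π)
sum-map-< {us = u ∷ _}  σ≤π (there a∈)  σa<πa = ℕP.+-mono-≤-< (σ≤π u) (sum-map-< σ≤π a∈ σa<πa)

content-injective-on : ∀ {us u v} → AllPairs (λ x y → content x ℤ.< content y) us →
  u ∈ us → v ∈ us → content u ≡ content v → u ≡ v
content-injective-on (_ ∷ _)   (here refl) (here refl) _  = refl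
content-injective-on (<s ∷ _)  (here refl) (there v∈)  eq = contradiction eq (ℤP.<⇒≢ (All.lookup <s v∈))
content-injective-on (<s ∷ _)  (there u∈)  (here refl) eq = contradiction (sym eq) (ℤP.<⇒≢ (All.lookup <s u∈))
content-injective-on (_ ∷ inc) (there u∈)  (there v∈)  eq = content-injective-on inc u∈ v∈ eq

lastC-∈ : ∀ a us → lastC a us ∈ a ∷ us
lastC-∈ a []       = here refl
lastC-∈ a (b ∷ us) = there (lastC-∈ b us)

lastC-map : ∀ (g : Cell → Cell) a us → lastC (g a) (map g us) ≡ g (lastC a us)
lastC-map g a []       = refl
lastC-map g a (b ∷ us) = lastC-map g b us

addCells-∈ : ∀ {π us u} → u ∈ us → addCells π us u ≡ suc (π u)
addCells-∈ {π} {us} {u} u∈ = cong (if_then suc (π u) else π u) (dec-true (u ∈? us) u∈)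

addCells-∉ : ∀ {π us u} → ¬ u ∈ us → addCells π us u ≡ π u
addCells-∉ {π} {us} {u} u∉ = cong (if_then suc (π u) else π u) (dec-false (u ∈? us) u∉)

removeCells : Filling → List Cell → Filling
removeCells π us u = if does (u ∈? us) then ℕ.pred (π u) else π u

removeCells-∈ : ∀ {π us u} → 0 < π u → u ∈ us → suc (removeCells π us u) ≡ π u
removeCells-∈ {π} {us} {u} 0<πu u∈ rewrite dec-true (u ∈? us) u∈ = ℕP.suc-pred (π u) {{ℕ.>-nonZero 0<πu}}

removeCells-∉ : ∀ {π us u} → ¬ u ∈ us → removeCells π us u ≡ π u
removeCells-∉ {π} {us} {u} u∉ = cong (if_then ℕ.pred (π u) else π u) (dec-false (u ∈? us) u∉)

removeCells-≤ : ∀ π us u → removeCells π us u ≤ π u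
removeCells-≤ π us u with does (u ∈? us)
... | true  = ℕP.pred[n]≤n
... | false = ℕP.≤-refl

-- `insertAll` applies the head of the list first, whereas extraction finds the last hook first; so
-- each new hook goes to the end.
insertAll-∷ʳ : ∀ λ′ hs h π → insertAll λ′ (hs ∷ʳ h) π ≡ insertHook λ′ h (insertAll λ′ hs π)
insertAll-∷ʳ λ′ []       h π = refl
insertAll-∷ʳ λ′ (g ∷ hs) h π = insertAll-∷ʳ λ′ hs h (insertHook λ′ g π)

AllInsert-∷ʳ : ∀ λ′ hs h π → AllInsert λ′ hs π → Inserts λ′ h (insertAll λ′ hs π) → AllInsert λ′ (hs ∷ʳ h) π
AllInsert-∷ʳ λ′ []       h π _         ins = ins , tt
AllInsert-∷ʳ λ′ (g ∷ hs) h π (i , ins) ins′ = i , AllInsert-∷ʳ λ′ hs h (insertHook λ′ g π) ins ins′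

-- Normalised reverse plane partitions.

module Extraction (λ′ : List ℕ) (partition : IsPartition λ′) where

  open Shape λ′ partition

  in? : Decidable In
  in? u = inλᵇ λ′ u Bool.≟ true

  -- Makes the value 0 at coordinates ≤ 0 literal, so that comparisons with w and n need no case for
  -- the border. Only cells of λ are compared with their west and north neighbours, so the value ∞
  -- is never consulted.
  record Normal (π : Filling) : Set where
    field
      outside : ∀ u → ¬ In u → π u ≡ 0
      w-≤     : ∀ u → In u → π (wC u) ≤ π u
      n-≤     : ∀ u → In u → π (nC u) ≤ π u

    positive⇒in : ∀ {u} → 0 < π u → In u
    positive⇒in {u} 0<πu with in? u
    ... | yes u∈ = u∈
    ... | no u∉  = contradiction (outside u u∉) (ℕP.>⇒≢ 0<πu)

    nw-≤ : ∀ u → In u → π (nC (wC u)) ≤ π (wC u)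
    nw-≤ (i , suc zero)    u∈ = subst (_≤ π (i , zero)) (sym (outside (nC (i , zero)) λ ())) z≤n
    nw-≤ (i , suc (suc j)) u∈ = n-≤ (i , suc j)
      (in-north-west i (suc (suc j)) u∈ (row≥1 i (suc (suc j)) u∈) ℕP.≤-refl (s≤s z≤n) (ℕP.n≤1+n _))

    isRPP : IsRPP λ′ π
    isRPP u u∈ = w-≤ (eC u) , n-≤ (sC u)

  normalise : Filling → Filling
  normalise π u = if inλᵇ λ′ u then π u else 0

  normalise-in : ∀ π {u} → In u → normalise π u ≡ π u
  normalise-in π {u} u∈ = cong (if_then π u else 0) u∈

  normalise-out : ∀ π {u} → ¬ In u → normalise π u ≡ 0
  normalise-out π {u} u∉ = cong (if_then π u else 0) (¬true⇒false u∉)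

  normalise-normal : ∀ {π} → IsRPP λ′ π → Normal (normalise π)
  normalise-normal {π} rpp = record { outside = λ u → normalise-out π {u} ; w-≤ = west ; n-≤ = north }
    where
    compare : ∀ v u → In u → (In v → π v ≤ π u) → normalise π v ≤ normalise π u
    compare v u u∈ v≤u with in? v
    ... | yes v∈ = subst₂ _≤_ (sym (normalise-in π {v} v∈)) (sym (normalise-in π {u} u∈)) (v≤u v∈)
    ... | no v∉  = subst (_≤ normalise π u) (sym (normalise-out π {v} v∉)) z≤n

    west : ∀ u → In u → normalise π (wC u) ≤ normalise π u
    west (i , suc j) u∈ = compare (i , j) (i , suc j) u∈ λ v∈ → proj₁ (rpp (i , j) v∈) u∈

    north : ∀ u → In u → normalise π (nC u) ≤ normalise π u
    north (zero , j)  u∈ = contradiction (row≥1 zero j u∈) λ ()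
    north (suc i , j) u∈ = compare (i , j) (suc i , j) u∈ λ v∈ → proj₂ (rpp (i , j) v∈) u∈

  -- Candidates and the walk from a maximal one.

  Candidate : Filling → Cell → Set
  Candidate π v = In v × east (ℤ.pred (content v)) ≡ true × π (wC v) < π v

  candidate? : ∀ π → Decidable (Candidate π)
  candidate? π v = in? v ×-dec (east (ℤ.pred (content v)) Bool.≟ true) ×-dec (π (wC v) ℕ.<? π v)

  -- If ε(c(u) - 1) holds then π(u) ≤ π(w u), otherwise s u ∈ λ and π(u) ≤ π(s u). Both neighbours
  -- have content c(u) - 1, and `n` bounds c(u) + ℓ. The descent ends west of λ, where π is 0.
  no-candidate⇒zero : ∀ {π} → Normal π → (∀ v → ¬ Candidate π v) → ∀ u → In u → π u ≡ 0
  no-candidate⇒zero {π} normal none (i₀ , j₀) = go (j₀ ℕ.+ ℓ) i₀ j₀ (ℕP.m≤m+n _ i₀)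
    where
    open Normal normal

    go : ∀ n i j → j ℕ.+ ℓ ≤ n ℕ.+ i → In (i , j) → π (i , j) ≡ 0
    go-w : ∀ n i j → j ℕ.+ ℓ ≤ n ℕ.+ i → π (i , j) ≡ 0

    go-w n i j bound with in? (i , j)
    ... | yes w∈ = go n i j bound w∈
    ... | no w∉  = outside (i , j) w∉

    go n i zero bound ()
    go zero i (suc j) bound u∈ = contradiction (row≤ℓ i (suc j) u∈)
      (ℕP.<⇒≱ (ℕP.≤-trans (s≤s (ℕP.m≤n+m ℓ j)) bound))
    go (suc n) i (suc j) bound u∈ with east (ℤ.pred (content (i , suc j))) in eq
    ... | true = ℕP.n≤0⇒n≡0 (subst (π (i , suc j) ≤_) (go-w n i j (ℕP.≤-pred bound))
                   (ℕP.≮⇒≥ λ w<u → none (i , suc j) (u∈ , eq , w<u)))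
    ... | false = ℕP.n≤0⇒n≡0 (subst (π (i , suc j) ≤_)
                    (go n (suc i) (suc j) (subst (suc j ℕ.+ ℓ ≤_) (sym (ℕP.+-suc n i)) bound) s∈)
                    (n-≤ (suc i , suc j) s∈))
      where s∈ = ¬east⇒in-s (i , suc j) u∈ eq

  -- Each step stores the strict drop of π to a north or west neighbour that the walk does not
  -- visit. This slack is what keeps the lowered filling monotone.
  data Trace (π : Filling) : Cell → List Cell → Set where
    stop     : ∀ {i j} → In (i , j) → ¬ In (i , suc j) → π (nC (i , j)) < π (i , j) →
               Trace π (i , j) []
    go-north : ∀ {i j us} → In (suc i , j) → east (content (suc i , j)) ≡ false →
               π (i , j) ≡ π (suc i , j) → π (wC (i , j)) < π (i , j) →
               Trace π (i , j) us → Trace π (suc i , j) ((i , j) ∷ us)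
    go-east  : ∀ {i j us} → In (i , j) → π (nC (i , j)) < π (i , j) →
               (east (content (i , j)) ≡ true → π (i , j) ≡ π (i , suc j)) →
               Trace π (i , suc j) us → Trace π (i , j) ((i , suc j) ∷ us)

  -- The invariant is π(n w u) < π(u). The fuel `n` bounds λ₁ - c(u), which falls by one at each
  -- step.
  trace-exists : ∀ {π} → Normal π → ∀ c → (∀ v → Candidate π v → content v ℤ.≤ c) →
    ∀ u → In u → c ℤ.≤ content u → π (nC (wC u)) < π u → ∃[ us ] Trace π u us
  trace-exists {π} normal c max (i₀ , j₀) = go (i₀ ℕ.+ rowLen λ′ 1) i₀ j₀ (ℕP.m≤m+n _ j₀)
    where
    open Normal normal

    go : ∀ n i j → i ℕ.+ rowLen λ′ 1 ≤ n ℕ.+ j → In (i , j) → c ℤ.≤ content (i , j) →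
      π (nC (wC (i , j))) < π (i , j) → ∃[ us ] Trace π (i , j) us
    go n zero j bound u∈ _ _ = contradiction (row≥1 zero j u∈) λ ()
    go n (suc i) zero bound () _ _
    go zero (suc i) (suc j) bound u∈ _ _ = contradiction
      (ℕP.≤-trans (proj₂ (proj₂ (∈λ⁻ {λ′} {suc i} {suc j} u∈))) (rowLen-antitone (proj₁ partition) (s≤s z≤n) (s≤s z≤n)))
      (ℕP.<⇒≱ (ℕP.≤-trans (s≤s (ℕP.m≤n+m (rowLen λ′ 1) i)) bound))
    go (suc n) (suc i) (suc j) bound u∈ c≤ nw<
      with π (i , suc j) ℕ.≟ π (suc i , suc j)
    ... | yes n≡ = _ , go-north u∈ not-east n≡ w<n (proj₂ rest)
      where
      w<n : π (i , j) < π (i , suc j)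
      w<n = subst (π (i , j) <_) (sym n≡) nw<
      -- π(n u) is positive and π vanishes outside λ, so u is not in the top row.
      n∈ : In (i , suc j)
      n∈ = positive⇒in (ℕP.≤-<-trans z≤n w<n)
      c< : c ℤ.< content (i , suc j)
      c< = ℤP.≤-<-trans c≤ (subst (content (suc i , suc j) ℤ.<_) (sym (content-s i (suc j))) (i<suc[i] _))
      not-east : east (content (suc i , suc j)) ≡ false
      not-east = ¬true⇒false λ e → ℤP.<⇒≱ c<
        (max (i , suc j) (n∈ , trans (cong east (sym (content-s-pred i (suc j)))) e , w<n))
      -- For v = n u the invariant follows from π(n w v) ≤ π(w v) < π(v).
      rest : ∃[ us ] Trace π (i , suc j) us
      rest = go n i (suc j) (ℕP.≤-pred bound) n∈ (ℤP.<⇒≤ c<) (ℕP.≤-<-trans (nw-≤ (i , suc j) n∈) w<n)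
    ... | no n≢ with in? (suc i , suc (suc j))
    ...   | no e∉ = _ , stop u∈ e∉ n<
      where
      n< : π (i , suc j) < π (suc i , suc j)
      n< = ℕP.≤∧≢⇒< (n-≤ (suc i , suc j) u∈) n≢
    ...   | yes e∈ = _ , go-east u∈ n< equal (proj₂ rest)
      where
      n< : π (i , suc j) < π (suc i , suc j)
      n< = ℕP.≤∧≢⇒< (n-≤ (suc i , suc j) u∈) n≢
      c< : c ℤ.< content (suc i , suc (suc j))
      c< = ℤP.≤-<-trans c≤ (subst (content (suc i , suc j) ℤ.<_) (sym (content-e (suc i) (suc j))) (i<suc[i] _))
      equal : east (content (suc i , suc j)) ≡ true → π (suc i , suc j) ≡ π (suc i , suc (suc j))
      equal e with π (suc i , suc j) ℕ.≟ π (suc i , suc (suc j))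
      ... | yes eq = eq
      ... | no neq = contradiction
        (max (suc i , suc (suc j)) (e∈ , trans (cong east (sym (content-w-pred (suc i) (suc j)))) e
          , ℕP.≤∧≢⇒< (w-≤ (suc i , suc (suc j)) e∈) neq)) (ℤP.<⇒≱ c<)
      -- For v = e u the cell n w v is n u, and π(n u) < π(u) ≤ π(v).
      rest : ∃[ us ] Trace π (suc i , suc (suc j)) us
      rest = go n (suc i) (suc (suc j)) (subst (suc i ℕ.+ rowLen λ′ 1 ≤_) (sym (ℕP.+-suc n (suc j))) bound)
        e∈ (ℤP.<⇒≤ c<) (ℕP.<-≤-trans n< (w-≤ (suc i , suc (suc j)) e∈))

  -- The insertion path retraces the walk.

  nextSW : Filling → Cell → Cell
  nextSW τ u = if (inBᵇ λ′ u ∨ inIᵇ λ′ u) ∧ inλᵇ λ′ (sC u) ∧ does (τ u ℕ.≟ τ (sC u)) then sC u else wC u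

  -- The list is peeled at its south-west end while `swPath` starts at the other end. The `m`
  -- further steps let the induction hypothesis run on through the peeled cell.
  swPath-retraces : ∀ τ {a us} → Linked (λ u v → nextSW τ v ≡ u) (a ∷ us) → ∀ m →
    swPath λ′ τ (length us ℕ.+ m) (lastC a us) ≡ us ʳ++ swPath λ′ τ m a
  swPath-retraces τ [-] m = refl
  swPath-retraces τ {a} {b ∷ us} (next ∷ linked) m =
    trans (cong (λ k → swPath λ′ τ k (lastC b us)) (sym (ℕP.+-suc (length us) m)))
      (trans (swPath-retraces τ linked (suc m))
        (cong (λ v → us ʳ++ (b ∷ swPath λ′ τ m v)) next))

  trace-head : ∀ {π u us} → Trace π u us → In u
  trace-head (stop u∈ _ _)         = u∈
  trace-head (go-north u∈ _ _ _ _) = u∈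
  trace-head (go-east u∈ _ _ _)    = u∈

  trace-in : ∀ {π u us} → Trace π u us → All In (u ∷ us)
  trace-in (stop u∈ _ _)         = u∈ ∷ []
  trace-in (go-north u∈ _ _ _ t) = u∈ ∷ trace-in t
  trace-in (go-east u∈ _ _ t)    = u∈ ∷ trace-in t

  -- One induction serves increasing contents, north-east steps, and north-east steps between the
  -- projections to the strip.
  trace-linked : ∀ {π} {R : Cell → Cell → Set} →
    (∀ u v → In u → In v → NEStep u v → content v ≡ ℤ.suc (content u) → R u v) →
    ∀ {u us} → Trace π u us → Linked R (u ∷ us)
  trace-linked step (stop _ _ _) = [-]
  trace-linked step (go-north {i} {j} u∈ _ _ _ t) =
    step (suc i , j) (i , j) u∈ (trace-head t) (inj₁ refl) (content-s i j) ∷ trace-linked step t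
  trace-linked step (go-east {i} {j} u∈ _ _ t) =
    step (i , j) (i , suc j) u∈ (trace-head t) (inj₂ refl) (content-e i j) ∷ trace-linked step t

  trace-increasing : ∀ {π u us} → Trace π u us → AllPairs (λ x y → content x ℤ.< content y) (u ∷ us)
  trace-increasing t = LinkedP.Linked⇒AllPairs ℤP.<-trans
    (trace-linked (λ u v _ _ _ c≡ → subst (content u ℤ.<_) (sym c≡) (i<suc[i] (content u))) t)

  trace-positive : ∀ {π u us} → Trace π u us → ∀ {x} → x ∈ u ∷ us → 0 < π x
  trace-positive (stop _ _ n<)          (here refl) = ℕP.≤-<-trans z≤n n<
  trace-positive (go-north _ _ n≡ w< _) (here refl) = subst (0 <_) n≡ (ℕP.≤-<-trans z≤n w<)
  trace-positive (go-east _ n< _ _)     (here refl) = ℕP.≤-<-trans z≤n n<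
  trace-positive (go-north _ _ _ _ t)   (there x∈)  = trace-positive t x∈
  trace-positive (go-east _ _ _ t)      (there x∈)  = trace-positive t x∈

  trace-n : ∀ {π u us} → Trace π u us → ∀ {x} → x ∈ u ∷ us → nC x ∈ u ∷ us ⊎ π (nC x) < π x
  trace-n (stop _ _ n<)        (here refl) = inj₂ n<
  trace-n (go-north _ _ _ _ _) (here refl) = inj₁ (there (here refl))
  trace-n (go-east _ n< _ _)   (here refl) = inj₂ n<
  trace-n (go-north _ _ _ _ t) (there x∈)  = Sum.map₁ there (trace-n t x∈)
  trace-n (go-east _ _ _ t)    (there x∈)  = Sum.map₁ there (trace-n t x∈)

  -- The head is left out because its drop to the west comes from the candidate condition; `trace-w`
  -- adds it.
  trace-w-tail : ∀ {π u us} → Trace π u us → ∀ {x} → x ∈ us → wC x ∈ u ∷ us ⊎ π (wC x) < π x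
  trace-w-tail (go-north _ _ _ w< _) (here refl) = inj₂ w<
  trace-w-tail (go-east _ _ _ _)     (here refl) = inj₁ (here refl)
  trace-w-tail (go-north _ _ _ _ t)  (there x∈)  = Sum.map₁ there (trace-w-tail t x∈)
  trace-w-tail (go-east _ _ _ t)     (there x∈)  = Sum.map₁ there (trace-w-tail t x∈)

  trace-w : ∀ {π u us} → Trace π u us → π (wC u) < π u → ∀ {x} → x ∈ u ∷ us → wC x ∈ u ∷ us ⊎ π (wC x) < π x
  trace-w t w< (here refl) = inj₂ w<
  trace-w t w< (there x∈)  = trace-w-tail t x∈

  -- Where ε holds the walk cannot stop, since e x ∈ λ, and cannot go north.
  trace-e : ∀ {π u us} → Trace π u us → ∀ {x} → x ∈ u ∷ us → east (content x) ≡ true →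
    eC x ∈ u ∷ us × π x ≡ π (eC x)
  trace-e (stop {i} {j} u∈ e∉ _) (here refl) e = contradiction (east⇒in-e (i , j) u∈ e) e∉
  trace-e (go-north _ ne _ _ _)  (here refl) e = contradiction ne (true≢false e)
  trace-e (go-east _ _ equal _)  (here refl) e = there (here refl) , equal e
  trace-e (go-north _ _ _ _ t)   (there x∈)  e = let e∈ , eq = trace-e t x∈ e in there e∈ , eq
  trace-e (go-east _ _ _ t)      (there x∈)  e = let e∈ , eq = trace-e t x∈ e in there e∈ , eq

  trace-last : ∀ {π u us} → Trace π u us → ¬ In (eC (lastC u us))
  trace-last (stop _ e∉ _)        = e∉
  trace-last (go-north _ _ _ _ t) = trace-last t
  trace-last (go-east _ _ _ t)    = trace-last t

  -- Contents rise by one along the walk, so s x on the walk must be the cell just before x. The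
  -- step between them went north, where π is constant.
  trace-s : ∀ {π u us} → Trace π u us → ∀ {x} → x ∈ u ∷ us → sC x ∈ u ∷ us → π x ≡ π (sC x)
  trace-s t (here refl) (here eq) = contradiction (cong proj₁ eq) ℕP.1+n≢n
  trace-s t {i , j} (here refl) (there s∈) = contradiction
    (All.lookup (AllPairs.head (trace-increasing t)) s∈)
    (ℤP.<-asym (subst (content (suc i , j) ℤ.<_) (sym (content-s i j)) (i<suc[i] _)))
  trace-s (go-north _ _ n≡ _ _) (there x∈) (here refl) = n≡
  trace-s (go-east _ _ _ t) {i , j} (there x∈) (here refl) = contradiction
    (cong proj₁ (content-injective-on (trace-increasing t) x∈ (here refl)
      (trans (content-s i j) (sym (content-e (suc i) j))))) (ℕP.1+n≢n ∘ sym)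
  trace-s (go-north _ _ _ _ t) (there x∈) (there s∈) = trace-s t x∈ s∈
  trace-s (go-east _ _ _ t)    (there x∈) (there s∈) = trace-s t x∈ s∈

  -- A relation instead of an equation with `removeCells`, because the filling produced by the
  -- earlier hooks is known only on λ.
  record Lowered (π : Filling) (ps : List Cell) (τ : Filling) : Set where
    field
      on  : ∀ {u} → u ∈ ps → suc (τ u) ≡ π u
      off : ∀ {u} → In u → ¬ u ∈ ps → τ u ≡ π u

  module _ {π τ : Filling} {ps : List Cell} (normal : Normal π)
    (increasing : AllPairs (λ x y → content x ℤ.< content y) ps) (lowered : Lowered π ps τ) where
    open Normal normal
    open Lowered lowered

    -- ε fails one content below (i , j), so this cell is in 𝓑 ∪ 𝓘; two equal values that both drop
    -- by one stay equal.
    nextSW-north : ∀ i j → (i , j) ∈ ps → (suc i , j) ∈ ps → In (i , j) → In (suc i , j) →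
      east (content (suc i , j)) ≡ false → π (i , j) ≡ π (suc i , j) → nextSW τ (i , j) ≡ (suc i , j)
    nextSW-north i j v∈ u∈ v∈λ u∈λ ne n≡ = cong (if_then (suc i , j) else wC (i , j))
      (cong₂ _∧_ (¬east⇒B∪I (i , j) v∈λ (trans (cong east (sym (content-s-pred i j))) ne))
        (cong₂ _∧_ u∈λ (dec-true (τ (i , j) ℕ.≟ τ (suc i , j))
          (ℕP.suc-injective (trans (on v∈) (trans n≡ (sym (on u∈))))))))

    -- With v = (i , suc j), s v has the content of (i , j), and the walk meets each content once,
    -- so s v is off the walk. If s v ∈ λ, then τ(s v) = π(s v) ≥ π(v) = τ(v) + 1, which blocks the
    -- move south.
    nextSW-east : ∀ i j → (i , j) ∈ ps → (i , suc j) ∈ ps → nextSW τ (i , suc j) ≡ (i , j)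
    nextSW-east i j u∈ v∈ = cong (if_then (suc i , suc j) else (i , j))
      (¬true⇒false λ h → blocked (proj₂ (∧-true⁻ (inBᵇ λ′ (i , suc j) ∨ inIᵇ λ′ (i , suc j)) h)))
      where
      s∉ : ¬ (suc i , suc j) ∈ ps
      s∉ s∈ = ℕP.1+n≢n (cong proj₁ (content-injective-on increasing s∈ u∈ (content-es i j)))

      blocked : ¬ inλᵇ λ′ (suc i , suc j) ∧ does (τ (i , suc j) ℕ.≟ τ (suc i , suc j)) ≡ true
      blocked h with ∧-true⁻ (inλᵇ λ′ (suc i , suc j)) h
      ... | s∈ , same = ℕP.<⇒≢ (subst₂ _≤_ (sym (on v∈)) (sym (off s∈ s∉)) (n-≤ (suc i , suc j) s∈))
                          (does-true⁻ (τ (i , suc j) ℕ.≟ τ (suc i , suc j)) same)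

    trace-nextSW : ∀ {u us} → Trace π u us → (∀ {x} → x ∈ u ∷ us → x ∈ ps) →
      Linked (λ a b → nextSW τ b ≡ a) (u ∷ us)
    trace-nextSW (stop _ _ _) ⊆ps = [-]
    trace-nextSW (go-north {i} {j} u∈ ne n≡ _ t) ⊆ps =
      nextSW-north i j (⊆ps (there (here refl))) (⊆ps (here refl)) (trace-head t) u∈ ne n≡
      ∷ trace-nextSW t (⊆ps ∘ there)
    trace-nextSW (go-east {i} {j} _ _ _ t) ⊆ps =
      nextSW-east i j (⊆ps (here refl)) (⊆ps (there (here refl))) ∷ trace-nextSW t (⊆ps ∘ there)

  -- Used for d = w and d = n. Lowering u can break the inequality only if π(d u) = π(u) and d u is
  -- not lowered too, which `closed` excludes.
  lowered-≤ : ∀ {π ps σ} (d : Cell → Cell) → Lowered π ps σ → (∀ u → σ u ≤ π u) → ∀ u → In u → π (d u) ≤ π u →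
    (u ∈ ps → d u ∈ ps ⊎ π (d u) < π u) → σ (d u) ≤ σ u
  lowered-≤ {π} {ps} {σ} d lowered σ≤π u u∈λ d≤ closed with u ∈? ps
  ... | no u∉ = ℕP.≤-trans (σ≤π (d u)) (subst (π (d u) ≤_) (sym (Lowered.off lowered u∈λ u∉)) d≤)
  ... | yes u∈ with closed u∈
  ...   | inj₁ d∈ = ℕP.≤-pred (subst₂ _≤_ (sym (Lowered.on lowered d∈)) (sym (Lowered.on lowered u∈)) d≤)
  ...   | inj₂ d< = ℕP.≤-pred (subst (suc (σ (d u)) ≤_) (sym (Lowered.on lowered u∈)) (ℕP.≤-<-trans (σ≤π (d u)) d<))

  -- The rim-hook below the walk and the lowered filling.

  module Hook {π : Filling} (normal : Normal π) {α : Cell} {us : List Cell} (t : Trace π α us)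
    (α-east : east (ℤ.pred (content α)) ≡ true) (α-w : π (wC α) < π α) where
    open Normal normal

    ps : List Cell
    ps = α ∷ us

    σ : Filling
    σ = removeCells π ps

    hook : Path
    hook = rim (content α) , map (rim ∘ content) us

    ω : Cell
    ω = lastC α us

    ω∈ : In ω
    ω∈ = All.lookup (trace-in t) (lastC-∈ α us)

    -- es ω ∈ λ would force e ω ∈ λ, but the walk ends where its row ends. So projection to the
    -- strip fixes ω.
    ω-rim : Rim ω
    ω-rim = ω∈ , λ es∈ → trace-last t
      (in-north-west _ _ es∈ (row≥1 (proj₁ ω) (proj₂ ω) ω∈) (ℕP.n≤1+n _) (s≤s z≤n) ℕP.≤-refl)

    hook-ω : ωP hook ≡ ω
    hook-ω = trans (lastC-map (rim ∘ content) α us) (rim-fixed ω ω-rim)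

    α∈ : In α
    α∈ = trace-head t

    hook-rims : All Rim (pathCells hook)
    hook-rims = AllP.map⁺ {xs = ps} (All.map (λ {u} → rim-of-cell u) (trace-in t))

    hook-isRimHook : IsRimHook λ′ hook
    hook-isRimHook =
      (All.map proj₁ hook-rims , LinkedP.map⁺ {xs = ps} (trace-linked step t))
      -- A cell of λ below the head of the hook would make ε(c(α) - 1) false, against α being a
      -- candidate.
      , (λ s∈ → true≢false α-east (trans (cong (east ∘ ℤ.pred) (sym (rim-content (content α))))
          (in-s⇒¬east (rim (content α)) (rim-of-cell α α∈) s∈)))
      , subst (λ v → ¬ In (eC v)) (sym hook-ω) (trace-last t)
      , All.map proj₂ hook-rims
      where
      step : ∀ u v → In u → In v → NEStep u v → content v ≡ ℤ.suc (content u) →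
        NEStep (rim (content u)) (rim (content v))
      step u v u∈ v∈ _ c≡ = rim-next (rim (content u)) v (rim-of-cell u u∈) v∈
        (trans c≡ (cong ℤ.suc (sym (rim-content (content u)))))

    σ-lowered : Lowered π ps σ
    σ-lowered = record
      { on  = λ {u} u∈ → removeCells-∈ {π} {ps} (trace-positive t u∈) u∈
      ; off = λ _ u∉ → removeCells-∉ {π} {ps} u∉ }

    σ-normal : Normal σ
    σ-normal = record
      { outside = λ u u∉ → trans (removeCells-∉ {π} {ps} (λ u∈ → u∉ (All.lookup (trace-in t) u∈))) (outside u u∉)
      ; w-≤ = λ u u∈ → lowered-≤ wC σ-lowered (removeCells-≤ π ps) u u∈ (w-≤ u u∈) (trace-w t α-w)
      ; n-≤ = λ u u∈ → lowered-≤ nC σ-lowered (removeCells-≤ π ps) u u∈ (n-≤ u u∈) (trace-n t)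
      }

    σ<π : sum (map σ (cells λ′)) < sum (map π (cells λ′))
    σ<π = sum-map-< (removeCells-≤ π ps) (∈cells⁺ {λ′} {α} α∈) (ℕP.≤-reflexive (Lowered.on σ-lowered (here refl)))

    module _ {τ : Filling} (τ≈σ : τ ≈[ λ′ ] σ) where

      τ-lowered : Lowered π ps τ
      τ-lowered = record
        { on  = λ {u} u∈ → trans (cong suc (τ≈σ u (All.lookup (trace-in t) u∈))) (Lowered.on σ-lowered u∈)
        ; off = λ {u} u∈ u∉ → trans (τ≈σ u u∈) (Lowered.off σ-lowered u∈ u∉) }
      open Lowered τ-lowered

      addCells-restores : ∀ qs → (∀ {u} → u ∈ ps → u ∈ qs) → (∀ {u} → u ∈ qs → u ∈ ps) →
        ∀ u → In u → addCells τ qs u ≡ π u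
      addCells-restores qs ps⊆ qs⊆ u u∈ with u ∈? ps
      ... | yes u∈ps = trans (addCells-∈ {τ} {qs} (ps⊆ u∈ps)) (on u∈ps)
      ... | no u∉ps  = trans (addCells-∉ {τ} {qs} (u∉ps ∘ qs⊆)) (off u∈ u∉ps)

      swPath≡reverse : swPath λ′ τ (lenP hook) (ωP hook) ≡ reverse ps
      swPath≡reverse = trans
        (cong₂ (swPath λ′ τ) (trans (length-map (rim ∘ content) us) (sym (ℕP.+-identityʳ (length us)))) hook-ω)
        (swPath-retraces τ (trace-nextSW normal (trace-increasing t) τ-lowered t (λ x∈ → x∈)) 0)

      insertHook-restores : insertHook λ′ hook τ ≈[ λ′ ] π
      insertHook-restores u u∈ = trans (cong (λ qs → addCells τ qs u) swPath≡reverse)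
        (addCells-restores (reverse ps) AnyP.reverse⁺ AnyP.reverse⁻ u u∈)

      -- The walk itself is the witness P. Compatibility passes from π to τ since both cells
      -- compared are lowered, and τ + P agrees with π on λ, so it is a reverse plane partition.
      hook-inserts : Inserts λ′ hook τ
      hook-inserts = (α , us)
        , (trace-in t , trace-linked (λ _ _ _ _ step _ → step) t)
        , sym hook-ω
        , sym (length-map (rim ∘ content) us)
        , ( (λ u u∈ h → let e∈ , eq = trace-e t u∈ (I∪A⇒east u h) in e∈ , same u∈ e∈ eq)
          , (λ u u∈ s∈ → same u∈ s∈ (trace-s t u∈ s∈)) )
        , λ u u∈ → (λ e∈ → restored u∈ e∈ (proj₁ (isRPP u u∈) e∈)) , (λ s∈ → restored u∈ s∈ (proj₂ (isRPP u u∈) s∈))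
        where
        same : ∀ {u v} → u ∈ ps → v ∈ ps → π u ≡ π v → τ u ≡ τ v
        same u∈ v∈ eq = ℕP.suc-injective (trans (on u∈) (trans eq (sym (on v∈))))

        restored : ∀ {u v} → In u → In v → π u ≤ π v → addCells τ ps u ≤ addCells τ ps v
        restored {u} {v} u∈ v∈ = subst₂ _≤_ (sym (addCells-restores ps (λ x → x) (λ x → x) u u∈))
                                           (sym (addCells-restores ps (λ x → x) (λ x → x) v v∈))

  -- Induction on the sum of the entries.

  HookSequence : Filling → List Path → Set
  HookSequence π hs = All (IsRimHook λ′) hs × AllInsert λ′ hs zeroF × (π ≈[ λ′ ] insertAll λ′ hs zeroF)

  hookSequence : ∀ π → Acc _<_ (sum (map π (cells λ′))) → Normal π → ∃[ hs ] HookSequence π hs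
  hookSequence π (acc rec) normal with ∃-max-content (candidate? π) (cells λ′)
  ... | inj₁ none = [] , [] , tt , no-candidate⇒zero normal (λ v cand → none (∈cells⁺ {λ′} {v} (proj₁ cand)) cand)
  ... | inj₂ (α , (α∈ , α-east , α-w) , max)
    with trace-exists normal (content α) (λ v cand → max (∈cells⁺ {λ′} {v} (proj₁ cand)) cand) α α∈ ℤP.≤-refl
           (ℕP.≤-<-trans (Normal.nw-≤ normal α α∈) α-w)
  ...   | us , t with hookSequence (Hook.σ normal t α-east α-w) (rec (Hook.σ<π normal t α-east α-w))
                        (Hook.σ-normal normal t α-east α-w)
  ...     | hs , rimHooks , inserts , σ≈ = hs ∷ʳ hook
        , AllP.∷ʳ⁺ rimHooks hook-isRimHook
        , AllInsert-∷ʳ λ′ hs hook zeroF inserts (hook-inserts τ≈σ)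
        , λ u u∈ → trans (sym (insertHook-restores τ≈σ u u∈)) (cong (λ ρ → ρ u) (sym (insertAll-∷ʳ λ′ hs hook zeroF)))
    where
    open Hook normal t α-east α-w
    τ≈σ : insertAll λ′ hs zeroF ≈[ λ′ ] σ
    τ≈σ u u∈ = sym (σ≈ u u∈)

mainTheorem9 : (λ′ : List ℕ) → IsPartition λ′ → (π : Filling) → IsRPP λ′ π →
    ∃[ hs ] All (IsRimHook λ′) hs × AllInsert λ′ hs zeroF × (π ≈[ λ′ ] insertAll λ′ hs zeroF)
mainTheorem9 λ′ partition π rpp =
  -- Normalising changes π only outside λ.
  let hs , rimHooks , inserts , π≈ = hookSequence (normalise π) (<-wellFounded _) (normalise-normal rpp)
  in hs , rimHooks , inserts , λ u u∈ → trans (sym (normalise-in π {u} u∈)) (π≈ u u∈)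
  where open Extraction λ′ partition
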